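{- Let $k\ge 1$ and $t\ge 3$ be fixed integers, and let $n\ge k$, with asymptotic notation referring to $n\to\infty$. (a) If $t=3$ and $k<4$, then $m_3(n,k)=\Omega(n^{\lfloor k/2\rfloor})$; and if $t\ge 4$ and $k<2(t-1)$, then $m_t(n,k)\ge n^{\lfloor \frac{(t-2)k}{t-1}\rfloor-o(1)}$. (b) If $t=3$ and $k\ge 4$, then $m_3(n,k)=\Omega(n^{k/2})$; and if $t\ge 4$ and $k\ge 2(t-1)$, then $m_t(n,k)\ge n^{\frac{(t-2)k}{t-1}-o(1)}$.
   Context: A maximal independent set (MIS) of a graph is an independent set that is maximal with respect to inclusion; a $k$-MIS is an MIS of size $k$. A graph is $K_t$-free if it contains no clique on $t$ vertices. $m_t(n,k)$ denotes the maximum number of $k$-MIS's in a $K_t$-free graph on $n$ vertices. -}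

module Defs where

open import Data.Bool using (Bool; true; false; _∧_; _∨_; not; if_then_else_)
open import Data.Nat using (ℕ; zero; suc; _+_; _⊔_; _≡ᵇ_)
open import Data.Fin using (Fin; zero; suc; toℕ)
open import Data.List using (List; []; _∷_; map; concatMap; foldr; filter; length; allFin)
open import Data.Bool.ListAction using (all; any)
open import Relation.Nullary.Decidable using (does)
open import Relation.Binary.PropositionalEquality using (_≡_)
open import Data.Bool.Properties using (T?)

allFuns : {A : Set} → (m : ℕ) → List A → List (Fin m → A)
allFuns zero    xs = (λ ()) ∷ []
allFuns (suc m) xs =
  concatMap (λ a → map (λ f → λ { zero → a ; (suc i) → f i }) (allFuns m xs)) xs

bools : List Bool
bools = true ∷ false ∷ []

-- A (raw) graph on vertex set Fin n: a 0/1 matrix.  The simple graph it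
-- represents has an edge {i,j} iff i ≠ j and both G i j and G j i are true.
-- Every finite simple graph on Fin n arises this way.
RawGraph : ℕ → Set
RawGraph n = Fin n → Fin n → Bool

_≟ᶠ_ : {n : ℕ} → Fin n → Fin n → Bool
i ≟ᶠ j = toℕ i ≡ᵇ toℕ j

adj : {n : ℕ} → RawGraph n → Fin n → Fin n → Bool
adj G i j = not (i ≟ᶠ j) ∧ G i j ∧ G j i

allGraphs : (n : ℕ) → List (RawGraph n)
allGraphs n = allFuns n (allFuns n bools)

VSet : ℕ → Set
VSet n = Fin n → Bool

allVSets : (n : ℕ) → List (VSet n)
allVSets n = allFuns n bools

size : {n : ℕ} → VSet n → ℕ
size {n} S = length (filter (λ i → T? (S i)) (allFin n))

isIndependent : {n : ℕ} → RawGraph n → VSet n → Bool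
isIndependent {n} G S =
  all (λ i → all (λ j → not (S i ∧ S j ∧ adj G i j)) (allFin n)) (allFin n)

isMaximal : {n : ℕ} → RawGraph n → VSet n → Bool
isMaximal {n} G S =
  all (λ v → S v ∨ any (λ u → S u ∧ adj G u v) (allFin n)) (allFin n)

isKMIS : {n : ℕ} → RawGraph n → ℕ → VSet n → Bool
isKMIS G k S = isIndependent G S ∧ isMaximal G S ∧ (size S ≡ᵇ k)

numKMIS : {n : ℕ} → RawGraph n → ℕ → ℕ
numKMIS {n} G k = length (filter (λ S → T? (isKMIS G k S)) (allVSets n))

isClique : {n : ℕ} → RawGraph n → VSet n → Bool
isClique {n} G S =
  all (λ i → all (λ j → not (S i ∧ S j ∧ not (i ≟ᶠ j)) ∨ adj G i j) (allFin n)) (allFin n)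

isKtFree : {n : ℕ} → ℕ → RawGraph n → Bool
isKtFree {n} t G =
  all (λ S → not ((size S ≡ᵇ t) ∧ isClique G S)) (allVSets n)

m : ℕ → ℕ → ℕ → ℕ
m t n k = foldr _⊔_ 0 (map (λ G → numKMIS G k)
                              (filter (λ G → T? (isKtFree t G)) (allGraphs n)))

{-# OPTIONS --safe #-}
-- All constructions are instances of one scheme, with s = t − 1. There are k parts, each vertex of a part carries p vectors,
-- and the k p vector slots are grouped into windows with at most s slots, in pairwise different parts. A configuration
-- chooses the vectors so that in each window one distinguished vector is the sum of the others.
-- Only vertices whose vectors have prescribed norms are used, and those of parts sharing a window are joined unless the
-- inner products of their vectors are the prescribed ones; by the pigeonhole principle some choice of prescribed values is realised by all but a
-- factor n^o(1) of the configurations. Each of these is an independent transversal, and it is maximal: prescribed inner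
-- products with the other vectors of a window determine ⟨ v , x ⟩ = ⟨ x , x ⟩ = ⟨ v , v ⟩ by linearity, hence v = x.
-- For t = 3 windows have at most two slots, whose vectors are equal, and recording equality alone costs only a constant.
-- For k < 2s one or two disjoint windows are used; for k ≥ 2s the windows are the k cyclic intervals of length s,
-- where parts at cyclic distance below s are related and cliques of parts have size at most s.
module Submission where

open import Defs
open import Data.Nat using (ℕ; zero; suc; _+_; _*_; _∸_; _^_; _≤_; _<_; _/_; _%_; _⊔_; _≡ᵇ_; s≤s; z≤n; ∣_-_∣; NonZero; >-nonZero; ≢-nonZero)
open import Data.Product using (_×_; _,_; proj₁; proj₂; ∃; ∃₂; ∃-syntax; uncurry)
open import Relation.Binary.PropositionalEquality hiding (J)
open import Data.Bool using (Bool; true; false; _∧_; _∨_; not; T; if_then_else_)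
open import Data.Bool.ListAction using (all; any)
open import Data.Bool.Properties using (T?; T-∧; T-∨)
open import Data.Empty using (⊥)
open import Data.Fin using (Fin; zero; suc; toℕ; cast; combine; remQuot; splitAt; join; inject≤; fromℕ<; funToFin; finToFun; punchIn)
open import Data.Fin.Properties using (injective⇒≤; toℕ-injective; combine-injective; inject≤-injective)
import Data.Fin.Properties as Fin
open import Data.List using (List; map; filter; length; lookup; allFin; foldr)
open import Data.List.Membership.Propositional using (_∈_)
open import Data.List.Membership.Propositional.Properties using (∈-lookup; ∈-allFin; ∈-filter⁺; ∈-filter⁻; ∈-map⁺; ∈-map⁻)
open import Data.List.Membership.Propositional.Properties.WithK using (unique∧set⇒bag)
open import Data.List.Properties using (map-cong; length-map; length-tabulate; filter-≐)
open import Data.List.Relation.Binary.BagAndSetEquality using (∼bag⇒↭)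
open import Data.List.Relation.Binary.Permutation.Propositional.Properties using (↭-length)
import Data.List.Relation.Unary.All as All
import Data.List.Relation.Unary.All.Properties as All
open import Data.List.Relation.Unary.AllPairs using (_∷_)
open import Data.List.Relation.Unary.Any as Any using (Any; here; there)
import Data.List.Relation.Unary.Any.Properties as Any
open import Data.List.Relation.Unary.Unique.Propositional using (Unique)
import Data.List.Relation.Unary.Unique.Propositional.Properties as Unique
open import Data.Maybe using (Maybe; just; nothing)
open import Data.Nat.Divisibility using (n∣m*n)
import Data.Nat.DivMod as ℕ
import Data.Nat.Properties as ℕ
open import Data.Nat.Tactic.RingSolver using (solve-∀)
open import Data.Sum using (_⊎_; inj₁; inj₂; [_,_]′)
open import Data.Sum.Properties using (inj₂-injective)
open import Function using (_∘_; id; mk⇔; Equivalence; _⇔_)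
open import Relation.Nullary using (¬_; Dec; yes; no; contradiction)
open import Relation.Nullary.Decidable using (⌊_⌋; toWitness; fromWitness; _×-dec_; ¬?; decidable-stable; does)
open import Algebra.Properties.CommutativeMonoid.Sum ℕ.+-0-commutativeMonoid using (sum; sum-cong-≗; sum-remove; ∑-distrib-+; ∑-comm)
open import Algebra.Properties.Semiring.Sum ℕ.+-*-semiring using (*-distribˡ-sum)

-- Counting maximal independent sets

T-not⁺ : ∀ {b} → ¬ T b → T (not b)
T-not⁺ {true}  h = h _
T-not⁺ {false} _ = _

T-not⁻ : ∀ {b} → T (not b) → ¬ T b
T-not⁻ {false} _ ()

all-allFin⁺ : ∀ {n} {p : Fin n → Bool} → (∀ i → T (p i)) → T (all p (allFin n))
all-allFin⁺ {p = p} h = All.all⁻ p (All.tabulate⁺ h)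

all-allFin⁻ : ∀ {n} {p : Fin n → Bool} → T (all p (allFin n)) → ∀ i → T (p i)
all-allFin⁻ {n} {p} h = All.tabulate⁻ (All.all⁺ p (allFin n) h)

all-cong : ∀ {A : Set} {p q : A → Bool} → p ≗ q → all p ≗ all q
all-cong p≗q xs = cong (foldr _∧_ true) (map-cong p≗q xs)

any-cong : ∀ {A : Set} {p q : A → Bool} → p ≗ q → any p ≗ any q
any-cong p≗q xs = cong (foldr _∨_ false) (map-cong p≗q xs)

filter-T?-cong : ∀ {A : Set} {p q : A → Bool} → p ≗ q →
                 filter (λ x → T? (p x)) ≗ filter (λ x → T? (q x))
filter-T?-cong p≗q = filter-≐ _ _ ((λ {x} → subst T (p≗q x)) , (λ {x} → subst T (sym (p≗q x))))

lookup-injective : ∀ {A : Set} {xs : List A} → Unique xs →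
                   ∀ i j → lookup xs i ≡ lookup xs j → i ≡ j
lookup-injective (_  ∷ _) zero    zero    _  = refl
lookup-injective (x∉ ∷ _) zero    (suc j) eq = contradiction eq (All.lookup x∉ (∈-lookup j))
lookup-injective (x∉ ∷ _) (suc i) zero    eq = contradiction (sym eq) (All.lookup x∉ (∈-lookup i))
lookup-injective (_  ∷ u) (suc i) (suc j) eq = cong suc (lookup-injective u i j eq)

any-filter⁺ : ∀ {A : Set} {P : A → Set} {p : A → Bool} {xs} →
              (∀ x → P x → T (p x)) → Any P xs → Any P (filter (λ x → T? (p x)) xs)
any-filter⁺ {p = p} h ps with Any.filter⁺ (λ x → T? (p x)) ps
... | inj₁ r = r
... | inj₂ ¬q = contradiction (h _ (Any.lookup-result ps)) ¬q

-- Functions are enumerated only up to pointwise equality, hence the relational form.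
allFuns-complete : ∀ {A : Set} m {xs : List A} {R : Fin m → A → Set} →
                   (∀ i → Any (R i) xs) → Any (λ f → ∀ i → R i (f i)) (allFuns m xs)
allFuns-complete zero    _ = here (λ ())
allFuns-complete (suc m) h =
  Any.concat⁺ (Any.map⁺ (Any.map
    (λ r → Any.map⁺ (Any.map (λ rs → λ { zero → r ; (suc i) → rs i })
                             (allFuns-complete m (h ∘ suc))))
    (h zero)))

∈-bools : ∀ b → b ∈ bools
∈-bools true  = here refl
∈-bools false = there (here refl)

≤-max : ∀ {A : Set} (f : A → ℕ) {x} {xs} → Any (λ y → x ≤ f y) xs → x ≤ foldr _⊔_ 0 (map f xs)
≤-max f (here h)  = ℕ.≤-trans h (ℕ.m≤m⊔n _ _)
≤-max f (there h) = ℕ.≤-trans (≤-max f h) (ℕ.m≤n⊔m _ _)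

module _ {n : ℕ} {G H : RawGraph n} (G≗H : ∀ i j → G i j ≡ H i j) where

  adj-cong : ∀ i j → adj G i j ≡ adj H i j
  adj-cong i j = cong (not (i ≟ᶠ j) ∧_) (cong₂ _∧_ (G≗H i j) (G≗H j i))

  isKMIS-cong : ∀ k S → isKMIS G k S ≡ isKMIS H k S
  isKMIS-cong k S = cong₂ _∧_
    (all-cong (λ i → all-cong (λ j → cong (λ a → not (S i ∧ S j ∧ a)) (adj-cong i j)) (allFin n)) (allFin n))
    (cong (_∧ (size S ≡ᵇ k))
      (all-cong (λ v → cong (S v ∨_) (any-cong (λ u → cong (S u ∧_) (adj-cong u v)) (allFin n))) (allFin n)))

  numKMIS-cong : ∀ k → numKMIS G k ≡ numKMIS H k
  numKMIS-cong k = cong length (filter-T?-cong (isKMIS-cong k) (allVSets n))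

  isClique-cong : ∀ S → isClique G S ≡ isClique H S
  isClique-cong S =
    all-cong (λ i → all-cong (λ j → cong (not (S i ∧ S j ∧ not (i ≟ᶠ j)) ∨_) (adj-cong i j)) (allFin n)) (allFin n)

  isKtFree-cong : ∀ t → isKtFree t G ≡ isKtFree t H
  isKtFree-cong t = all-cong (λ S → cong (λ b → not ((size S ≡ᵇ t) ∧ b)) (isClique-cong S)) (allVSets n)

-- The list `allGraphs n` is only known to contain a pointwise copy of `G`; the congruence lemmas
-- carry freeness and the count over to that copy.
numKMIS≤m : ∀ {n} t k (G : RawGraph n) → T (isKtFree t G) → numKMIS G k ≤ m t n k
numKMIS≤m {n} t k G free = ≤-max (λ H → numKMIS H k)
  (Any.map (λ G≗H → ℕ.≤-reflexive (numKMIS-cong G≗H k))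
    (any-filter⁺ (λ H G≗H → subst T (isKtFree-cong G≗H t) free)
      (allFuns-complete n (λ i → allFuns-complete n (λ j → ∈-bools (G i j))))))

≟ᶠ⁻ : ∀ {n} {i j : Fin n} → T (i ≟ᶠ j) → i ≡ j
≟ᶠ⁻ {i = i} {j} h = toℕ-injective (ℕ.≡ᵇ⇒≡ (toℕ i) (toℕ j) h)

-- The members of a set of size `t`, listed without repetition, form the injective family `vs`;
-- injectivity turns `a ≢ b` into the distinctness that `isClique` asks for.
isKtFree⁺ : ∀ {n} t (G : RawGraph n) →
            (∀ (vs : Fin t → Fin n) → (∀ a b → a ≢ b → T (G (vs a) (vs b))) → ⊥) →
            T (isKtFree t G)
isKtFree⁺ {n} t G h = All.all⁻ _ (All.universal (λ S → T-not⁺ (noClique S)) (allVSets n))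
  where
  noClique : ∀ S → ¬ T ((size S ≡ᵇ t) ∧ isClique G S)
  noClique S hS = h vs edge
    where
    L = filter (λ i → T? (S i)) (allFin n)
    len : length L ≡ t
    len = ℕ.≡ᵇ⇒≡ _ _ (proj₁ (Equivalence.to T-∧ hS))
    clique : T (isClique G S)
    clique = proj₂ (Equivalence.to (T-∧ {size S ≡ᵇ t}) hS)
    vs : Fin t → Fin n
    vs a = lookup L (cast (sym len) a)
    vs-∈ : ∀ a → T (S (vs a))
    vs-∈ a = proj₂ (∈-filter⁻ (λ i → T? (S i)) {xs = allFin n} (∈-lookup (cast (sym len) a)))
    vs-injective : ∀ a b → vs a ≡ vs b → a ≡ b
    vs-injective a b eq = toℕ-injective (trans (sym (Fin.toℕ-cast (sym len) a)) (trans
      (cong toℕ (lookup-injective (Unique.filter⁺ (λ i → T? (S i)) (Unique.allFin⁺ n)) _ _ eq))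
      (Fin.toℕ-cast (sym len) b)))
    edge : ∀ a b → a ≢ b → T (G (vs a) (vs b))
    edge a b a≢b with Equivalence.to T-∨ (all-allFin⁻ (all-allFin⁻ clique (vs a)) (vs b))
    ... | inj₁ ¬in = contradiction
            (Equivalence.from T-∧ (vs-∈ a , Equivalence.from T-∧ (vs-∈ b , T-not⁺ (a≢b ∘ vs-injective a b ∘ ≟ᶠ⁻))))
            (T-not⁻ ¬in)
    ... | inj₂ ad = proj₁ (Equivalence.to T-∧ (proj₂ (Equivalence.to (T-∧ {not (vs a ≟ᶠ vs b)}) ad)))

IsImageOf : ∀ {n k} → VSet n → (Fin k → Fin n) → Set
IsImageOf S f = ∀ v → T (S v) ⇔ (∃ λ i → v ≡ f i)

-- Two duplicate-free lists with the same members are permutations of each other.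
size-image : ∀ {n k} {S : VSet n} {f : Fin k → Fin n} → (∀ {i j} → f i ≡ f j → i ≡ j) →
             IsImageOf S f → size S ≡ k
size-image {n} {k} {S} {f} f-inj img = trans
  (↭-length (∼bag⇒↭ (unique∧set⇒bag
    (Unique.filter⁺ S? (Unique.allFin⁺ n))
    (Unique.map⁺ f-inj (Unique.allFin⁺ k))
    (mk⇔ to from))))
  (trans (length-map f (allFin k)) (length-tabulate id))
  where
  S? = λ i → T? (S i)
  to : ∀ {v} → v ∈ filter S? (allFin n) → v ∈ map f (allFin k)
  to v∈ with (i , refl) ← Equivalence.to (img _) (proj₂ (∈-filter⁻ S? {xs = allFin n} v∈)) = ∈-map⁺ f (∈-allFin i)
  from : ∀ {v} → v ∈ map f (allFin k) → v ∈ filter S? (allFin n)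
  from v∈ with (i , _ , refl) ← ∈-map⁻ f v∈ = ∈-filter⁺ S? (∈-allFin (f i)) (Equivalence.from (img _) (i , refl))

record MaximalIndependent {n k} (G : RawGraph n) (f : Fin k → Fin n) : Set where
  field
    injective   : ∀ {i j} → f i ≡ f j → i ≡ j
    independent : ∀ i j → ¬ T (G (f i) (f j))
    maximal     : ∀ v → (∃ λ i → v ≡ f i) ⊎ (∃ λ i → T (G (f i) v) × T (G v (f i)))

isKMIS⁺ : ∀ {n k} {G : RawGraph n} {f : Fin k → Fin n} {S} →
          MaximalIndependent G f → IsImageOf S f → T (isKMIS G k S)
isKMIS⁺ {n} {k} {G} {f} {S} mi img =
  Equivalence.from T-∧ (indep , Equivalence.from T-∧ (maxi , ℕ.≡⇒≡ᵇ _ _ (size-image injective img)))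
  where
  open MaximalIndependent mi
  indep : T (isIndependent G S)
  indep = all-allFin⁺ λ u → all-allFin⁺ λ v → T-not⁺ λ h →
    let hu , h'  = Equivalence.to (T-∧ {S u}) h
        hv , ad  = Equivalence.to (T-∧ {S v}) h'
        i , u≡fi = Equivalence.to (img u) hu
        j , v≡fj = Equivalence.to (img v) hv
        guv      = proj₁ (Equivalence.to T-∧ (proj₂ (Equivalence.to (T-∧ {not (u ≟ᶠ v)}) ad)))
    in independent i j (subst₂ (λ a b → T (G a b)) u≡fi v≡fj guv)
  dominated : ∀ v → T (S v ∨ any (λ u → S u ∧ adj G u v) (allFin n))
  dominated v with T? (S v)
  ... | yes sv = Equivalence.from T-∨ (inj₁ sv)
  ... | no ¬sv with maximal v
  ...   | inj₁ e = contradiction (Equivalence.from (img v) e) ¬sv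
  ...   | inj₂ (i , g , g') = Equivalence.from (T-∨ {S v}) (inj₂ (Any.any⁺ _ (Any.tabulate⁺ (f i)
            (Equivalence.from T-∧ (sfi , Equivalence.from T-∧ (T-not⁺ fi≢v , Equivalence.from T-∧ (g , g')))))))
    where
    sfi : T (S (f i))
    sfi = Equivalence.from (img (f i)) (i , refl)
    fi≢v : ¬ T (f i ≟ᶠ v)
    fi≢v e = ¬sv (subst (T ∘ S) (≟ᶠ⁻ e) sfi)
  maxi : T (isMaximal G S)
  maxi = all-allFin⁺ dominated

image-exists : ∀ {n k} (f : Fin k → Fin n) → Any (λ S → IsImageOf S f) (allVSets n)
image-exists {n} f = allFuns-complete n λ v → decide v (Fin.any? (λ i → v Fin.≟ f i))
  where
  decide : ∀ v → Dec (∃ λ i → v ≡ f i) → Any (λ b → T b ⇔ (∃ λ i → v ≡ f i)) bools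
  decide v (yes e) = here (mk⇔ (λ _ → e) _)
  decide v (no ¬e) = there (here (mk⇔ (λ ()) ¬e))

-- Pigeonhole without choosing a most popular c: ω ↦ (κ ω , position of f ω among the k-MIS's of Gs (κ ω)) is injective.
count-MIS : ∀ {n k t F R} (Gs : Fin R → RawGraph n) (κ : Fin F → Fin R) (f : Fin F → Fin k → Fin n) →
            (∀ c → T (isKtFree t (Gs c))) →
            (∀ ω → MaximalIndependent (Gs (κ ω)) (f ω)) →
            (∀ ω ω' → (∀ v → (∃ λ i → v ≡ f ω i) ⇔ (∃ λ i → v ≡ f ω' i)) → ω ≡ ω') →
            F ≤ R * m t n k
count-MIS {n} {k} {t} Gs κ f free mi f-inj = injective⇒≤ {f = code} code-injective
  where
  mises : ∀ c → List (VSet n)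
  mises c = filter (λ S → T? (isKMIS (Gs c) k S)) (allVSets n)
  found : ∀ ω → Any (λ S → IsImageOf S (f ω)) (mises (κ ω))
  found ω = any-filter⁺ (λ S → isKMIS⁺ (mi ω)) (image-exists (f ω))
  idx : ∀ ω → Fin (m t n k)
  idx ω = inject≤ (Any.index (found ω)) (numKMIS≤m t k (Gs (κ ω)) (free (κ ω)))
  code : Fin _ → Fin _
  code ω = combine (κ ω) (idx ω)
  -- The two positions lie in lists that depend on the table, so `c` and `c'` stay general until
  -- `c ≡ c'` is matched with `refl`.
  same : ∀ ω ω' c c' (p : Any (λ S → IsImageOf S (f ω)) (mises c)) (p' : Any (λ S → IsImageOf S (f ω')) (mises c')) →
         c ≡ c' → toℕ (Any.index p) ≡ toℕ (Any.index p') → ω ≡ ω'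
  same ω ω' c .c p p' refl eq = f-inj ω ω' λ v → mk⇔
    (λ h → Equivalence.to (i' v) (Equivalence.from (i v) h))
    (λ h → Equivalence.to (i v) (Equivalence.from (i' v) h))
    where
    i  = Any.lookup-index p
    i' = subst (λ a → IsImageOf (lookup (mises c) a) (f ω')) (sym (toℕ-injective eq)) (Any.lookup-index p')
  code-injective : ∀ {ω ω'} → code ω ≡ code ω' → ω ≡ ω'
  code-injective {ω} {ω'} eq =
    let κ≡ , idx≡ = combine-injective (κ ω) (idx ω) (κ ω') (idx ω') eq
    in same ω ω' _ _ (found ω) (found ω') κ≡
         (trans (sym (Fin.toℕ-inject≤ _ _)) (trans (cong toℕ idx≡) (Fin.toℕ-inject≤ _ _)))

-- Graphs with prescribed profiles between parts

-- Vertices of part i carry labels in Fin N. For every possible table c of profiles there is a graph in which labels x, y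
-- of related parts i, l are joined unless their profile is the prescribed c i l, so a configuration
-- is an independent transversal of the graph of its own table, and maximal by rigidity.
-- The remaining vertices are joined to the whole of part 0.
module Blueprint
  {k' t' n N P F : ℕ}
  (fits : suc k' * N ≤ n)
  (_~_ : Fin (suc k') → Fin (suc k') → Set) (_~?_ : ∀ i l → Dec (i ~ l))
  (~-sym : ∀ {i l} → i ~ l → l ~ i) (~-irrefl : ∀ {i} → ¬ (i ~ i))
  (~-free : (g : Fin (3 + t') → Fin (suc k')) → ¬ (∀ a b → a ≢ b → g a ~ g b))
  (π : Fin N → Fin N → Fin P)
  (x : Fin F → Fin (suc k') → Fin N)
  (x-injective : ∀ ω ω' → (∀ i → x ω i ≡ x ω' i) → ω ≡ ω')
  (rigid : ∀ ω i v → π v v ≡ π (x ω i) (x ω i) →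
           (∀ l → i ~ l → π v (x ω l) ≡ π (x ω i) (x ω l) × π (x ω l) v ≡ π (x ω l) (x ω i)) →
           v ≡ x ω i)
  where

  k t : ℕ
  k = suc k'
  t = 3 + t'

  Label : Set
  Label = Maybe (Fin k × Fin N)

  place : Fin k → Fin N → Fin n
  place i a = inject≤ (combine i a) fits

  position : Fin n → Label
  position v with toℕ v ℕ.<? k * N
  ... | yes v< = just (remQuot N (fromℕ< v<))
  ... | no _   = nothing

  position-place : ∀ i a → position (place i a) ≡ just (i , a)
  position-place i a with toℕ (place i a) ℕ.<? k * N
  ... | yes v< = cong just (trans (cong (remQuot N) (toℕ-injective
          (trans (Fin.toℕ-fromℕ< v<) (Fin.toℕ-inject≤ (combine i a) fits)))) (Fin.remQuot-combine i a))
  ... | no v≮ = contradiction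
          (subst (_< k * N) (sym (Fin.toℕ-inject≤ (combine i a) fits)) (Fin.toℕ<n (combine i a))) v≮

  place-position : ∀ v {i a} → position v ≡ just (i , a) → v ≡ place i a
  place-position v eq with toℕ v ℕ.<? k * N
  place-position v refl | yes v< = toℕ-injective (trans (sym (Fin.toℕ-fromℕ< v<))
    (trans (cong toℕ (sym (Fin.combine-remQuot {k} N (fromℕ< v<)))) (sym (Fin.toℕ-inject≤ _ fits))))

  module _ (c : Fin k → Fin k → Fin P) where

    -- A vertex whose self-profile differs from `c i i` is treated like one outside all parts, so
    -- every live label meets the first condition of `rigid`.
    alive : Label → Label
    alive nothing = nothing
    alive (just (i , a)) with c i i Fin.≟ π a a
    ... | yes _ = just (i , a)
    ... | no _  = nothing

    label : Fin n → Label
    label v = alive (position v)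

    label-place : ∀ i a → c i i ≡ π a a → label (place i a) ≡ just (i , a)
    label-place i a e rewrite position-place i a with c i i Fin.≟ π a a
    ... | yes _ = refl
    ... | no ¬e = contradiction e ¬e

    place-label : ∀ v {i a} → label v ≡ just (i , a) → v ≡ place i a × c i i ≡ π a a
    place-label v eq with position v in pos
    ... | just (i , a) with c i i Fin.≟ π a a
    place-label v refl | just (i , a) | yes e = place-position v pos , e

    -- Comparing both orders of the profile makes the relation symmetric for an arbitrary `π`.
    Joined : Label → Label → Set
    Joined (just (i , a)) (just (l , b)) = i ~ l × ¬ (c i l ≡ π a b × c l i ≡ π b a)
    Joined (just (i , _)) nothing        = i ≡ zero
    Joined nothing        (just (l , _)) = l ≡ zero
    Joined nothing        nothing        = ⊥

    joined? : ∀ p q → Dec (Joined p q)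
    joined? (just (i , a)) (just (l , b)) =
      (i ~? l) ×-dec ¬? ((c i l Fin.≟ π a b) ×-dec (c l i Fin.≟ π b a))
    joined? (just (i , _)) nothing        = i Fin.≟ zero
    joined? nothing        (just (l , _)) = l Fin.≟ zero
    joined? nothing        nothing        = no λ ()

    Joined-sym : ∀ p q → Joined p q → Joined q p
    Joined-sym (just _) (just _) (i~l , ne) = ~-sym i~l , λ (e , e') → ne (e' , e)
    Joined-sym (just _) nothing  e = e
    Joined-sym nothing  (just _) e = e

    graph : RawGraph n
    graph u v = ⌊ joined? (label u) (label v) ⌋

    -- All neighbours of a dead vertex lie in part `zero` and are pairwise unjoined, so it is in no
    -- triangle, while `t` is at least 3. A clique of live vertices projects to pairwise related
    -- parts, against `~-free`.
    graph-free : T (isKtFree t graph)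
    graph-free = isKtFree⁺ t graph noClique
      where
      noClique : ∀ (vs : Fin t → Fin n) → ¬ (∀ a b → a ≢ b → T (graph (vs a) (vs b)))
      noClique vs clique = byDead (Fin.any? (λ a → isNothing? (label (vs a))))
        where
        isNothing? : ∀ (p : Label) → Dec (p ≡ nothing)
        isNothing? nothing  = yes refl
        isNothing? (just _) = no λ ()
        edge : ∀ a b → a ≢ b → Joined (label (vs a)) (label (vs b))
        edge a b a≢b = toWitness (clique a b a≢b)
        noTriangle : ∀ p q r → p ≡ nothing → Joined p q → Joined p r → ¬ Joined q r
        noTriangle nothing (just _) (just _) _ refl refl (0~0 , _) = ~-irrefl 0~0
        byDead : ¬ Dec (∃ λ a → label (vs a) ≡ nothing)
        byDead (yes (a , dead)) = noTriangle _ _ _ dead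
          (edge a b (Fin.punchInᵢ≢i a zero ∘ sym)) (edge a b' (Fin.punchInᵢ≢i a (suc zero) ∘ sym))
          (edge b b' (λ e → Fin.0≢1+n (Fin.punchIn-injective a zero (suc zero) e)))
          where
          b  = punchIn a zero
          b' = punchIn a (suc zero)
        byDead (no live) = ~-free (λ a → proj₁ (parts a)) related
          where
          part : ∀ p → p ≢ nothing → ∃ λ ((i , a) : Fin k × Fin N) → p ≡ just (i , a)
          part (just ia) _ = ia , refl
          part nothing  ne = contradiction refl ne
          parts : ∀ a → Fin k × Fin N
          parts a = proj₁ (part (label (vs a)) (λ e → live (a , e)))
          related : ∀ a b → a ≢ b → proj₁ (parts a) ~ proj₁ (parts b)
          related a b a≢b = proj₁ (subst₂ Joined (proj₂ (part (label (vs a)) _)) (proj₂ (part (label (vs b)) _)) (edge a b a≢b))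

    module _ (ω : Fin F) (matches : ∀ i l → c i l ≡ π (x ω i) (x ω l)) where

      transversal : Fin k → Fin n
      transversal i = place i (x ω i)

      label-transversal : ∀ i → label (transversal i) ≡ just (i , x ω i)
      label-transversal i = label-place i (x ω i) (matches i i)

      -- A dead vertex is dominated from part `zero`. A live vertex of part `i` unjoined to the
      -- whole transversal has the profiles of `x ω i`, hence equals it by `rigid`; decidability
      -- then yields the dominating part.
      transversal-MIS : MaximalIndependent graph transversal
      transversal-MIS = record
        { injective   = λ {i} {j} eq → Fin.combine-injectiveˡ i (x ω i) j (x ω j) (inject≤-injective fits fits _ _ eq)
        ; independent = λ i j h → indep i j (subst₂ Joined (label-transversal i) (label-transversal j) (toWitness h))
        ; maximal     = λ v → maxi v (label v) refl
        }
        where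
        indep : ∀ i j → ¬ Joined (just (i , x ω i)) (just (j , x ω j))
        indep i j (_ , ne) = ne (matches i j , matches j i)
        dominate : ∀ v i → Joined (just (i , x ω i)) (label v) →
                   ∃ λ i → T (graph (transversal i) v) × T (graph v (transversal i))
        dominate v i h = i , fromWitness h' , fromWitness (Joined-sym _ _ h')
          where h' = subst (λ p → Joined p (label v)) (sym (label-transversal i)) h
        maxi : ∀ v p → label v ≡ p →
               (∃ λ i → v ≡ transversal i) ⊎ (∃ λ i → T (graph (transversal i) v) × T (graph v (transversal i)))
        maxi v nothing eq = inj₂ (dominate v zero (subst (Joined _) (sym eq) refl))
        maxi v (just (i , a)) eq with place-label v eq
        ... | v≡ , live with a Fin.≟ x ω i
        ...   | yes a≡ = inj₁ (i , trans v≡ (cong (place i) a≡))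
        ...   | no a≢ with Fin.¬∀⟶∃¬ k _ (λ l → ¬? (joined? (just (l , x ω l)) (just (i , a)))) notIsolated
          where
          unjoined : ∀ l → i ~ l → ¬ Joined (just (l , x ω l)) (just (i , a)) →
                     π a (x ω l) ≡ π (x ω i) (x ω l) × π (x ω l) a ≡ π (x ω l) (x ω i)
          unjoined l i~l nj with decidable-stable ((c l i Fin.≟ π (x ω l) a) ×-dec (c i l Fin.≟ π a (x ω l)))
                                                  (λ ne → nj (~-sym i~l , ne))
          ... | e , e' = trans (sym e') (matches i l) , trans (sym e) (matches l i)
          notIsolated : ¬ (∀ l → ¬ Joined (just (l , x ω l)) (just (i , a)))
          notIsolated all = a≢ (rigid ω i a (trans (sym live) (matches i i)) (λ l i~l → unjoined l i~l (all l)))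
        ...     | l , nn = inj₂ (dominate v l (subst (Joined _) (sym eq) (decidable-stable (joined? _ _) nn)))

  profiles : Fin F → Fin ((P ^ k) ^ k)
  profiles ω = funToFin (λ i → funToFin (λ l → π (x ω i) (x ω l)))

  table : Fin ((P ^ k) ^ k) → Fin k → Fin k → Fin P
  table c i l = finToFun (finToFun c i) l

  table-profiles : ∀ ω i l → table (profiles ω) i l ≡ π (x ω i) (x ω l)
  table-profiles ω i l = trans
    (cong (λ e → finToFun e l) (Fin.finToFun-funToFin (λ i → funToFin (λ l → π (x ω i) (x ω l))) i))
    (Fin.finToFun-funToFin (λ l → π (x ω i) (x ω l)) l)

  transversals≤m : F ≤ (P ^ k) ^ k * m t n k
  transversals≤m = count-MIS (λ c → graph (table c)) profiles (λ ω i → place i (x ω i))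
    (λ c → graph-free (table c))
    (λ ω → transversal-MIS (table (profiles ω)) ω (table-profiles ω))
    same
    where
    same : ∀ ω ω' → (∀ v → (∃ λ i → v ≡ place i (x ω i)) ⇔ (∃ λ i → v ≡ place i (x ω' i))) → ω ≡ ω'
    same ω ω' img = x-injective ω ω' λ i → agree i (Equivalence.to (img _) (i , refl))
      where
      agree : ∀ i → (∃ λ j → place i (x ω i) ≡ place j (x ω' j)) → x ω i ≡ x ω' i
      agree i (j , eq) with combine-injective i (x ω i) j (x ω' j) (inject≤-injective fits fits _ _ eq)
      ... | refl , e = e

-- Windows and codings

funToFin-cong : ∀ {a b} {g h : Fin a → Fin b} → g ≗ h → funToFin g ≡ funToFin h
funToFin-cong {zero}  e = refl
funToFin-cong {suc a} e = cong₂ combine (e zero) (funToFin-cong (e ∘ suc))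

funToFin-injective : ∀ {a b} {g h : Fin a → Fin b} → funToFin g ≡ funToFin h → g ≗ h
funToFin-injective {g = g} {h} e i =
  trans (sym (Fin.finToFun-funToFin g i)) (trans (cong (λ c → finToFun c i) e) (Fin.finToFun-funToFin h i))

finToFun-injective : ∀ {a b} {v w : Fin (b ^ a)} → finToFun {b} {a} v ≗ finToFun w → v ≡ w
finToFun-injective {a} {b} {v} {w} e = trans (sym (Fin.funToFin-finToFin {a} {b} v))
  (trans (funToFin-cong e) (Fin.funToFin-finToFin {a} {b} w))

-- Every part has p slots, and the slots are grouped into J windows. Window j contains the slot inj₁ j,
-- whose value is determined by the values of the other slots of the window.
record Layout (k t p J f : ℕ) : Set where
  field
    slot : Fin k → Fin p → Fin J ⊎ Fin f
    window : Fin f → Fin J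

  windowOf : Fin J ⊎ Fin f → Fin J
  windowOf = [ id , window ]′

  _~_ : Fin k → Fin k → Set
  i ~ l = i ≢ l × ∃₂ λ a b → windowOf (slot i a) ≡ windowOf (slot l b)

  field
    slot-surjective : ∀ σ → ∃₂ λ i a → slot i a ≡ σ
    window-injective : ∀ i a b → windowOf (slot i a) ≡ windowOf (slot i b) → a ≡ b
    ~-free : (g : Fin t → Fin k) → ¬ (∀ a b → a ≢ b → g a ~ g b)

-- An assignment `z` fills the free slots and `value` computes the determined ones. The alphabets
-- `M₀` and `M` are separate because sums of vectors have larger coordinates.
record Coding {k t p J f} (L : Layout k t p J f) (M₀ M P : ℕ) : Set where
  open Layout L
  field
    value   : (Fin f → Fin M₀) → Fin J ⊎ Fin f → Fin M
    value-injective : ∀ z z' u → value z (inj₂ u) ≡ value z' (inj₂ u) → z u ≡ z' u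
    φ       : Fin M → Fin M → Fin P
    rigid   : ∀ z σ v → φ v v ≡ φ (value z σ) (value z σ) →
              (∀ τ → τ ≢ σ → windowOf τ ≡ windowOf σ → φ v (value z τ) ≡ φ (value z σ) (value z τ)) →
              v ≡ value z σ

-- A label is a `p`-tuple of values and its profile a `p` by `p` matrix of `φ`, so the tables number
-- `P` to the power of the number of slot pairs. Rigidity is checked slot by slot.
coding⇒≤m : ∀ {k' t' n p J f M₀ M P} (let k = suc k') (let t = suc (suc (suc t')))
            {L : Layout k t p J f} → Coding L M₀ M P → k * M ^ p ≤ n →
            M₀ ^ f ≤ P ^ (p * p * k * k) * m t n k
coding⇒≤m {k'} {t'} {n} {p} {J} {f} {M₀} {M} {P} {L} C fits =
  subst (λ e → M₀ ^ f ≤ e * m t n k) powers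
    (Blueprint.transversals≤m {k'} {t'} fits _~_ _~?_ ~-sym ~-irrefl ~-free π x x-injective x-rigid)
  where
  open Layout L
  open Coding C
  k = suc k'
  t = suc (suc (suc t'))
  powers : (((P ^ p) ^ p) ^ k) ^ k ≡ P ^ (p * p * k * k)
  powers = trans (cong (λ a → (a ^ k) ^ k) (ℕ.^-*-assoc P p p))
    (trans (cong (_^ k) (ℕ.^-*-assoc P (p * p) k)) (ℕ.^-*-assoc P (p * p * k) k))
  _~?_ : ∀ i l → Dec (i ~ l)
  i ~? l = ¬? (i Fin.≟ l) ×-dec Fin.any? (λ a → Fin.any? (λ b → windowOf (slot i a) Fin.≟ windowOf (slot l b)))
  ~-sym : ∀ {i l} → i ~ l → l ~ i
  ~-sym (i≢l , a , b , e) = i≢l ∘ sym , b , a , sym e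
  ~-irrefl : ∀ {i} → ¬ (i ~ i)
  ~-irrefl (i≢i , _) = i≢i refl
  profile : (Fin p → Fin M) → (Fin p → Fin M) → Fin ((P ^ p) ^ p)
  profile v w = funToFin (λ a → funToFin (λ b → φ (v a) (w b)))
  profile-injective : ∀ {v w v' w'} → profile v w ≡ profile v' w' → ∀ a b → φ (v a) (w b) ≡ φ (v' a) (w' b)
  profile-injective e a = funToFin-injective (funToFin-injective e a)
  π : Fin (M ^ p) → Fin (M ^ p) → Fin ((P ^ p) ^ p)
  π v w = profile (finToFun v) (finToFun w)
  z : Fin (M₀ ^ f) → Fin f → Fin M₀
  z = finToFun
  entry : Fin (M₀ ^ f) → Fin k → Fin p → Fin M
  entry ω i a = value (z ω) (slot i a)
  x : Fin (M₀ ^ f) → Fin k → Fin (M ^ p)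
  x ω i = funToFin (entry ω i)
  x-entry : ∀ ω i a → finToFun (x ω i) a ≡ entry ω i a
  x-entry ω i = Fin.finToFun-funToFin (entry ω i)
  x-injective : ∀ ω ω' → (∀ i → x ω i ≡ x ω' i) → ω ≡ ω'
  x-injective ω ω' e = finToFun-injective same
    where
    same : z ω ≗ z ω'
    same u with slot-surjective (inj₂ u)
    ... | i , a , s = value-injective (z ω) (z ω') u
            (subst (λ σ → value (z ω) σ ≡ value (z ω') σ) s (funToFin-injective (e i) a))
  x-rigid : ∀ ω i v → π v v ≡ π (x ω i) (x ω i) →
            (∀ l → i ~ l → π v (x ω l) ≡ π (x ω i) (x ω l) × π (x ω l) v ≡ π (x ω l) (x ω i)) →
            v ≡ x ω i
  x-rigid ω i v self others = finToFun-injective λ a → trans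
    (rigid (z ω) (slot i a) (finToFun v a)
      (trans (profile-injective self a a) (cong₂ φ (x-entry ω i a) (x-entry ω i a)))
      (λ τ τ≢ same → agree a τ τ≢ same (slot-surjective τ)))
    (sym (x-entry ω i a))
    where
    agree : ∀ a τ → τ ≢ slot i a → windowOf τ ≡ windowOf (slot i a) → (∃₂ λ l b → slot l b ≡ τ) →
            φ (finToFun v a) (value (z ω) τ) ≡ φ (value (z ω) (slot i a)) (value (z ω) τ)
    agree a _ τ≢ same (l , b , refl) = begin
      φ (finToFun v a) (entry ω l b)              ≡⟨ cong (φ _) (x-entry ω l b) ⟨
      φ (finToFun v a) (finToFun (x ω l) b)       ≡⟨ profile-injective (proj₁ (others l i~l)) a b ⟩
      φ (finToFun (x ω i) a) (finToFun (x ω l) b) ≡⟨ cong₂ φ (x-entry ω i a) (x-entry ω l b) ⟩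
      φ (entry ω i a) (entry ω l b)               ∎
      where
      open ≡-Reasoning
      -- A part meets a window in at most one slot, so another slot of the window belongs to another
      -- part.
      i≢l : i ≢ l
      i≢l refl = τ≢ (cong (slot i) (window-injective i b a same))
      i~l : i ~ l
      i~l = i≢l , a , b , sym same

-- Windows have at most two slots, which carry equal values, so φ only records equality of values. In a window with a
-- single slot the determined value is an empty sum, and φ also records that it is zero.
equalityCoding : ∀ {k t p J f} {L : Layout k t p J f} q →
                 (∀ {u u'} → Layout.window L u ≡ Layout.window L u' → u ≡ u') → Coding L (suc q) (suc q) 3
equalityCoding {J = J} {f} {L} q window-inj = record
  { value = value ; value-injective = λ _ _ _ → id ; φ = φ ; rigid = rigid }
  where
  open Layout L
  pick : (Fin f → Fin (suc q)) → ∀ j → Dec (∃ λ u → window u ≡ j) → Fin (suc q)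
  pick z j (yes (u , _)) = z u
  pick z j (no _)        = zero
  value : (Fin f → Fin (suc q)) → Fin J ⊎ Fin f → Fin (suc q)
  value z (inj₁ j) = pick z j (Fin.any? (λ u → window u Fin.≟ j))
  value z (inj₂ u) = z u
  φ : Fin (suc q) → Fin (suc q) → Fin 3
  φ v w with v Fin.≟ w | v Fin.≟ zero
  ... | no _  | _     = zero
  ... | yes _ | no _  = suc zero
  ... | yes _ | yes _ = suc (suc zero)
  φ-eq : ∀ v w → φ v w ≡ φ w w → v ≡ w
  φ-eq v w e with v Fin.≟ w | v Fin.≟ zero | w Fin.≟ w | w Fin.≟ zero
  ... | yes v≡w | _ | _ | _ = v≡w
  ... | no _ | _ | no w≢w | _ = contradiction refl w≢w
  φ-eq v w () | no _ | _ | yes _ | yes _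
  φ-eq v w () | no _ | _ | yes _ | no _
  φ-zero : ∀ v → φ v v ≡ φ zero zero → v ≡ zero
  φ-zero v e with v Fin.≟ v | v Fin.≟ zero
  ... | _ | yes v≡0 = v≡0
  φ-zero v () | yes _ | no _
  φ-zero v () | no _ | no _
  rigid : ∀ z σ v → φ v v ≡ φ (value z σ) (value z σ) →
          (∀ τ → τ ≢ σ → windowOf τ ≡ windowOf σ → φ v (value z τ) ≡ φ (value z σ) (value z τ)) →
          v ≡ value z σ
  rigid z (inj₁ j) v self others with Fin.any? (λ u → window u Fin.≟ j)
  ... | yes (u , w) = φ-eq v (z u) (others (inj₂ u) (λ ()) w)
  ... | no _        = φ-zero v self
  rigid z (inj₂ u) v self others
    with Fin.any? (λ u' → window u' Fin.≟ window u) | others (inj₁ (window u)) (λ ()) refl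
  -- The determined slot carries `z u'`, and injectivity of `window` identifies `u'` with `u`.
  ... | yes (u' , w) | h with refl ← window-inj w = φ-eq v (z u) h
  ... | no none      | _ = contradiction (u , refl) none

-- Sums and inner products over the natural numbers

sum-bound : ∀ {n b} (g : Fin n → ℕ) → (∀ i → g i ≤ b) → sum g ≤ n * b
sum-bound {zero}  g h = z≤n
sum-bound {suc n} g h = ℕ.+-mono-≤ (h zero) (sum-bound (g ∘ suc) (h ∘ suc))

sum≡0 : ∀ {n} (g : Fin n → ℕ) → sum g ≡ 0 → ∀ i → g i ≡ 0
sum≡0 g e zero    = ℕ.m+n≡0⇒m≡0 (g zero) e
sum≡0 g e (suc i) = sum≡0 (g ∘ suc) (ℕ.m+n≡0⇒n≡0 (g zero) e) i

sum-cancel : ∀ {n} (g h : Fin n → ℕ) i → sum g ≡ sum h → (∀ j → j ≢ i → g j ≡ h j) → g i ≡ h i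
sum-cancel {suc n} g h i e off = ℕ.+-cancelʳ-≡ _ (g i) (h i) (begin
  g i + sum (g ∘ punchIn i) ≡⟨ sum-remove g ⟨
  sum g                     ≡⟨ e ⟩
  sum h                     ≡⟨ sum-remove h ⟩
  h i + sum (h ∘ punchIn i) ≡⟨ cong (h i +_) (sum-cong-≗ (λ j → off (punchIn i j) (Fin.punchInᵢ≢i i j))) ⟨
  h i + sum (g ∘ punchIn i) ∎)
  where open ≡-Reasoning

-- The expansion of (a - b)², arranged to avoid subtraction.
squares : ∀ a b → a * a + b * b ≡ (a * b + a * b) + ∣ a - b ∣ * ∣ a - b ∣
squares a b with ℕ.≤-total a b
... | inj₁ a≤b with ℕ.m≤n⇒∃[o]m+o≡n a≤b
...   | δ , refl rewrite ℕ.∣m-m+n∣≡n a δ = lemma a δ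
  where
  lemma : ∀ a δ → a * a + (a + δ) * (a + δ) ≡ (a * (a + δ) + a * (a + δ)) + δ * δ
  lemma = solve-∀
squares a b | inj₂ b≤a with ℕ.m≤n⇒∃[o]m+o≡n b≤a
...   | δ , refl rewrite ℕ.∣-∣-comm (b + δ) b | ℕ.∣m-m+n∣≡n b δ = lemma b δ
  where
  lemma : ∀ b δ → (b + δ) * (b + δ) + b * b ≡ ((b + δ) * b + (b + δ) * b) + δ * δ
  lemma = solve-∀

module Vectors (Q d : ℕ) where

  coord : Fin (Q ^ d) → Fin d → ℕ
  coord v c = toℕ (finToFun {Q} {d} v c)

  coord≤ : ∀ v c → coord v c ≤ Q
  coord≤ v c = ℕ.<⇒≤ (Fin.toℕ<n (finToFun {Q} {d} v c))

  dot : Fin (Q ^ d) → Fin (Q ^ d) → ℕ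
  dot v w = sum (λ c → coord v c * coord w c)

  dot< : ∀ v w → dot v w < suc (d * (Q * Q))
  dot< v w = s≤s (sum-bound {d} {Q * Q} (λ c → coord v c * coord w c) (λ c → ℕ.*-mono-≤ (coord≤ v c) (coord≤ w c)))

  -- The hypotheses make ∥v - w∥² = ⟨v,v⟩ + ⟨w,w⟩ - 2⟨v,w⟩ vanish, and a vanishing sum of squares
  -- vanishes termwise.
  dot-definite : ∀ v w → dot v v ≡ dot w w → dot v w ≡ dot w w → v ≡ w
  dot-definite v w vv vw = finToFun-injective {d} {Q} λ c → toℕ-injective
    (ℕ.∣m-n∣≡0⇒m≡n (square≡0 _ (sum≡0 (λ c → ∣ coord v c - coord w c ∣ * ∣ coord v c - coord w c ∣) dist≡0 c)))
    where
    open ≡-Reasoning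
    square≡0 : ∀ a → a * a ≡ 0 → a ≡ 0
    square≡0 zero _ = refl
    dist = sum (λ c → ∣ coord v c - coord w c ∣ * ∣ coord v c - coord w c ∣)
    dist≡0 : dist ≡ 0
    dist≡0 = ℕ.+-cancelˡ-≡ (dot w w + dot w w) dist 0 (begin
      (dot w w + dot w w) + dist ≡⟨ cong (λ a → (a + a) + dist) vw ⟨
      (dot v w + dot v w) + dist ≡⟨ cong (_+ dist) (∑-distrib-+ (λ c → coord v c * coord w c) _) ⟨
      sum (λ c → coord v c * coord w c + coord v c * coord w c) + dist
                                 ≡⟨ ∑-distrib-+ (λ c → coord v c * coord w c + coord v c * coord w c) _ ⟨
      sum (λ c → (coord v c * coord w c + coord v c * coord w c) + ∣ coord v c - coord w c ∣ * ∣ coord v c - coord w c ∣)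
                                 ≡⟨ sum-cong-≗ (λ c → squares (coord v c) (coord w c)) ⟨
      sum (λ c → coord v c * coord v c + coord w c * coord w c)
                                 ≡⟨ ∑-distrib-+ (λ c → coord v c * coord v c) _ ⟩
      dot v v + dot w w          ≡⟨ cong (_+ dot w w) vv ⟩
      dot w w + dot w w          ≡⟨ ℕ.+-identityʳ _ ⟨
      (dot w w + dot w w) + 0    ∎)

-- x = Σ yᵢ makes ⟨v , x⟩ = Σ ⟨v , yᵢ⟩, so agreement of v with one vector of the window on
-- all the others forces agreement on that vector too, and then ∥ v − w ∥² = 0.
gramCoding : ∀ {k t p J f} {L : Layout k t p J f} B d →
             Coding L (suc B ^ d) ((suc f * suc B) ^ d) (suc (d * ((suc f * suc B) * (suc f * suc B))))
gramCoding {J = J} {f} {L} B d = record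
  { value = value ; value-injective = value-injective ; φ = φ ; rigid = rigid }
  where
  open Layout L
  -- Large enough for a sum of `f` coordinates below `suc B`.
  Q = suc f * suc B
  open Vectors Q d
  open Vectors (suc B) d using () renaming (coord to coord₀)
  Free = Fin f → Fin (suc B ^ d)
  -- The indicator of a window, which turns sums over the window into sums over all free slots.
  χ : Fin J → Fin f → ℕ
  χ j u = if does (window u Fin.≟ j) then 1 else 0
  χ≤1 : ∀ j u → χ j u ≤ 1
  χ≤1 j u with does (window u Fin.≟ j)
  ... | true  = s≤s z≤n
  ... | false = z≤n
  χ-refl : ∀ u → χ (window u) u ≡ 1
  χ-refl u with window u Fin.≟ window u
  ... | yes _ = refl
  ... | no ≢ = contradiction refl ≢
  χ-* : ∀ j u a b → (window u ≡ j → a ≡ b) → χ j u * a ≡ χ j u * b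
  χ-* j u a b h with window u Fin.≟ j
  ... | yes e = cong (1 *_) (h e)
  ... | no _  = refl
  total : Free → Fin J → Fin d → ℕ
  total z j c = sum (λ u → χ j u * coord₀ (z u) c)
  total< : ∀ z j c → total z j c < Q
  total< z j c = ℕ.≤-<-trans
    (sum-bound _ (λ u → ℕ.≤-trans (ℕ.*-mono-≤ (χ≤1 j u) (ℕ.<⇒≤ (Fin.toℕ<n _))) (ℕ.≤-reflexive (ℕ.*-identityˡ (suc B)))))
    (ℕ.m<n+m (f * suc B) (s≤s z≤n))
  value : Free → Fin J ⊎ Fin f → Fin (Q ^ d)
  value z (inj₁ j) = funToFin (λ c → fromℕ< (total< z j c))
  value z (inj₂ u) = funToFin (λ c → inject≤ (finToFun {suc B} {d} (z u) c) (ℕ.m≤m+n (suc B) (f * suc B)))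
  coord-rep : ∀ z j c → coord (value z (inj₁ j)) c ≡ total z j c
  coord-rep z j c = trans (cong toℕ (Fin.finToFun-funToFin (λ c → fromℕ< (total< z j c)) c)) (Fin.toℕ-fromℕ< _)
  coord-free : ∀ z u c → coord (value z (inj₂ u)) c ≡ coord₀ (z u) c
  coord-free z u c = trans
    (cong toℕ (Fin.finToFun-funToFin (λ c → inject≤ (finToFun {suc B} {d} (z u) c) (ℕ.m≤m+n (suc B) (f * suc B))) c))
    (Fin.toℕ-inject≤ _ (ℕ.m≤m+n (suc B) (f * suc B)))
  value-injective : ∀ z z' u → value z (inj₂ u) ≡ value z' (inj₂ u) → z u ≡ z' u
  value-injective z z' u e = finToFun-injective {d} {suc B} λ c → toℕ-injective
    (trans (sym (coord-free z u c)) (trans (cong (λ v → coord v c) e) (coord-free z' u c)))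
  -- Linearity, by interchanging the sums over coordinates and over free slots.
  dot-rep : ∀ z j v → dot v (value z (inj₁ j)) ≡ sum (λ u → χ j u * dot v (value z (inj₂ u)))
  dot-rep z j v = begin
    sum (λ c → coord v c * coord (value z (inj₁ j)) c)
      ≡⟨ sum-cong-≗ (λ c → cong (coord v c *_) (coord-rep z j c)) ⟩
    sum (λ c → coord v c * total z j c)
      ≡⟨ sum-cong-≗ (λ c → *-distribˡ-sum (coord v c) (λ u → χ j u * coord₀ (z u) c)) ⟩
    sum (λ c → sum (λ u → coord v c * (χ j u * coord₀ (z u) c)))
      ≡⟨ ∑-comm (λ c u → coord v c * (χ j u * coord₀ (z u) c)) ⟩
    sum (λ u → sum (λ c → coord v c * (χ j u * coord₀ (z u) c)))
      ≡⟨ sum-cong-≗ (λ u → sum-cong-≗ (λ c → trans (swap (coord v c) (χ j u) (coord₀ (z u) c))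
           (cong (λ a → χ j u * (coord v c * a)) (sym (coord-free z u c))))) ⟩
    sum (λ u → sum (λ c → χ j u * (coord v c * coord (value z (inj₂ u)) c)))
      ≡⟨ sum-cong-≗ (λ u → *-distribˡ-sum (χ j u) (λ c → coord v c * coord (value z (inj₂ u)) c)) ⟨
    sum (λ u → χ j u * dot v (value z (inj₂ u))) ∎
    where
    open ≡-Reasoning
    swap : ∀ a b c → a * (b * c) ≡ b * (a * c)
    swap = solve-∀
  φ : Fin (Q ^ d) → Fin (Q ^ d) → Fin (suc (d * (Q * Q)))
  φ v w = fromℕ< (dot< v w)
  φ⇒dot : ∀ v w v' w' → φ v w ≡ φ v' w' → dot v w ≡ dot v' w'
  φ⇒dot v w v' w' e = trans (sym (Fin.toℕ-fromℕ< (dot< v w))) (trans (cong toℕ e) (Fin.toℕ-fromℕ< (dot< v' w')))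
  rigid : ∀ z σ v → φ v v ≡ φ (value z σ) (value z σ) →
          (∀ τ → τ ≢ σ → windowOf τ ≡ windowOf σ → φ v (value z τ) ≡ φ (value z σ) (value z τ)) →
          v ≡ value z σ
  rigid z σ v self others = dot-definite v w (φ⇒dot v v w w self) (agree σ refl)
    where
    open ≡-Reasoning
    w = value z σ
    off : ∀ τ → τ ≢ σ → windowOf τ ≡ windowOf σ → dot v (value z τ) ≡ dot w (value z τ)
    off τ τ≢ same = φ⇒dot v _ w _ (others τ τ≢ same)
    agree : ∀ τ → τ ≡ σ → dot v (value z τ) ≡ dot w (value z τ)
    agree (inj₁ j) refl = begin
      dot v (value z (inj₁ j))                     ≡⟨ dot-rep z j v ⟩
      sum (λ u → χ j u * dot v (value z (inj₂ u))) ≡⟨ sum-cong-≗ (λ u → χ-* j u _ _ (off (inj₂ u) (λ ()))) ⟩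
      sum (λ u → χ j u * dot w (value z (inj₂ u))) ≡⟨ dot-rep z j w ⟨
      dot w (value z (inj₁ j))                     ∎
    -- The inner product with the window's sum vector is known; cancelling the other free slots
    -- leaves the term of `u`, whose coefficient is 1.
    agree (inj₂ u) refl = ℕ.*-cancelˡ-≡ _ _ 1 (subst
      (λ a → a * dot v (value z (inj₂ u)) ≡ a * dot w (value z (inj₂ u))) (χ-refl u)
      (sum-cancel (λ u' → χ j u' * dot v (value z (inj₂ u'))) (λ u' → χ j u' * dot w (value z (inj₂ u'))) u
        (begin
          sum (λ u' → χ j u' * dot v (value z (inj₂ u'))) ≡⟨ dot-rep z j v ⟨
          dot v (value z (inj₁ j))                        ≡⟨ off (inj₁ j) (λ ()) refl ⟩
          dot w (value z (inj₁ j))                        ≡⟨ dot-rep z j w ⟩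
          sum (λ u' → χ j u' * dot w (value z (inj₂ u'))) ∎)
        (λ u' u'≢u → χ-* j u' _ _ (off (inj₂ u') (u'≢u ∘ inj₂-injective)))))
      where j = window u

-- The two window systems

-- Windows are the residue classes of part indices modulo `J`, and the first `J` parts hold the
-- determined slots. By `bound` the quotients are below `s`, so among `suc s` pairwise related parts
-- two would share quotient and residue.
residueLayout : ∀ s J' f (let J = suc J') → J + f ≤ s * J → Layout (J + f) (suc s) 1 J f
residueLayout s J' f bound = record
  { slot = slot ; window = window
  ; slot-surjective = λ σ → join J f σ , zero , Fin.splitAt-join J f σ
  ; window-injective = λ { _ zero zero _ → refl }
  ; ~-free = free }
  where
  J = suc J'
  slot : Fin (J + f) → Fin 1 → Fin J ⊎ Fin f
  slot i _ = splitAt J i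
  window : Fin f → Fin J
  window u = fromℕ< (ℕ.m%n<n (toℕ u) J)
  windowOf : Fin J ⊎ Fin f → Fin J
  windowOf = [ id , window ]′
  windowOf-join : ∀ σ → toℕ (windowOf σ) ≡ toℕ (join J f σ) % J
  windowOf-join (inj₁ j) = sym (trans (cong (_% J) (Fin.toℕ-↑ˡ j f)) (ℕ.m<n⇒m%n≡m (Fin.toℕ<n j)))
  windowOf-join (inj₂ u) = trans (Fin.toℕ-fromℕ< (ℕ.m%n<n (toℕ u) J)) (sym (trans
    (cong (_% J) (trans (Fin.toℕ-↑ʳ J u) (ℕ.+-comm J (toℕ u)))) (ℕ.[m+n]%n≡m%n (toℕ u) J)))
  windowOf-slot : ∀ i a → toℕ (windowOf (slot i a)) ≡ toℕ i % J
  windowOf-slot i a = trans (windowOf-join (splitAt J i)) (cong (λ i → toℕ i % J) (Fin.join-splitAt J f i))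
  quotient< : ∀ (i : Fin (J + f)) → toℕ i / J < s
  quotient< i = ℕ.m<n*o⇒m/o<n (ℕ.<-≤-trans (Fin.toℕ<n i) bound)
  free : (g : Fin (suc s) → Fin (J + f)) →
         ¬ (∀ a b → a ≢ b → g a ≢ g b × ∃₂ λ c d → windowOf (slot (g a) c) ≡ windowOf (slot (g b) d))
  free g clique with Fin.pigeonhole (ℕ.n<1+n s) (λ a → fromℕ< (quotient< (g a)))
  ... | a , b , a<b , e with clique a b (Fin.<⇒≢ a<b)
  ...   | ga≢gb , c , d , w = ga≢gb (toℕ-injective (begin
    toℕ (g a)                               ≡⟨ ℕ.m≡m%n+[m/n]*n (toℕ (g a)) J ⟩
    toℕ (g a) % J + toℕ (g a) / J * J       ≡⟨ cong₂ (λ q r → q + r * J) same% same/ ⟩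
    toℕ (g b) % J + toℕ (g b) / J * J       ≡⟨ ℕ.m≡m%n+[m/n]*n (toℕ (g b)) J ⟨
    toℕ (g b)                               ∎))
    where
    open ≡-Reasoning
    same% : toℕ (g a) % J ≡ toℕ (g b) % J
    same% = trans (sym (windowOf-slot (g a) c)) (trans (cong toℕ w) (windowOf-slot (g b) d))
    same/ : toℕ (g a) / J ≡ toℕ (g b) / J
    same/ = trans (sym (Fin.toℕ-fromℕ< (quotient< (g a)))) (trans (cong toℕ e) (Fin.toℕ-fromℕ< (quotient< (g b))))

-- For `s = 2` the bound gives `f ≤ J`, so reduction modulo `J` fixes every free index.
residueLayout-window-injective : ∀ J' f (bound : suc J' + f ≤ 2 * suc J') {u u'} →
  Layout.window (residueLayout 2 J' f bound) u ≡ Layout.window (residueLayout 2 J' f bound) u' → u ≡ u'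
residueLayout-window-injective J' f bound {u} {u'} e =
  toℕ-injective (trans (sym (reduce u)) (trans (cong toℕ e) (reduce u')))
  where
  J = suc J'
  f≤J : f ≤ J
  f≤J = subst (f ≤_) (ℕ.+-identityʳ J) (ℕ.+-cancelˡ-≤ J f (J + 0) bound)
  reduce : ∀ u → toℕ (fromℕ< (ℕ.m%n<n (toℕ u) J)) ≡ toℕ u
  reduce u = trans (Fin.toℕ-fromℕ< (ℕ.m%n<n (toℕ u) J)) (ℕ.m<n⇒m%n≡m (ℕ.<-≤-trans (Fin.toℕ<n u) f≤J))

minimum : ∀ {n} (g : Fin (suc n) → ℕ) → ∃ λ i → ∀ j → g i ≤ g j
minimum {zero}  g = zero , λ { zero → ℕ.≤-refl }
minimum {suc n} g with minimum (g ∘ suc)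
... | i , least with ℕ.≤-total (g zero) (g (suc i))
...   | inj₁ g0≤ = zero , λ { zero → ℕ.≤-refl ; (suc j) → ℕ.≤-trans g0≤ (least j) }
...   | inj₂ gi≤ = suc i , λ { zero → gi≤ ; (suc j) → least j }

module Cyclic (k : ℕ) where

  -- The part `a` steps before `i` on a cycle of length `k`; the second alternative is the
  -- wrap-around.
  back : ∀ (i : Fin k) a → a ≤ k → ∃ λ (w : Fin k) → toℕ w + a ≡ toℕ i ⊎ toℕ w + a ≡ toℕ i + k
  back i a a≤k with a ℕ.≤? toℕ i
  ... | yes a≤i = fromℕ< (ℕ.≤-<-trans (ℕ.m∸n≤m (toℕ i) a) (Fin.toℕ<n i)) ,
                  inj₁ (trans (cong (_+ a) (Fin.toℕ-fromℕ< _)) (ℕ.m∸n+n≡m a≤i))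
  ... | no a≰i  = fromℕ< i+k∸a<k , inj₂ (trans (cong (_+ a) (Fin.toℕ-fromℕ< i+k∸a<k)) cancel)
    where
    cancel : (toℕ i + k ∸ a) + a ≡ toℕ i + k
    cancel = ℕ.m∸n+n≡m (ℕ.≤-trans a≤k (ℕ.m≤n+m k (toℕ i)))
    i+k∸a<k : toℕ i + k ∸ a < k
    i+k∸a<k = ℕ.+-cancelʳ-< a _ _ (subst (_< k + a) (sym cancel)
      (subst (toℕ i + k <_) (ℕ.+-comm a k) (ℕ.+-monoˡ-< k (ℕ.≰⇒> a≰i))))

  back-injective : ∀ {i l a} (a≤k : a ≤ k) → proj₁ (back i a a≤k) ≡ proj₁ (back l a a≤k) → i ≡ l
  back-injective {i} {l} {a} a≤k e with proj₂ (back i a a≤k) | proj₂ (back l a a≤k)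
  ... | p | q rewrite e = cases p q
    where
    cases : ∀ {w} → w ≡ toℕ i ⊎ w ≡ toℕ i + k → w ≡ toℕ l ⊎ w ≡ toℕ l + k → i ≡ l
    cases (inj₁ p) (inj₁ q) = toℕ-injective (trans (sym p) q)
    cases (inj₂ p) (inj₂ q) = toℕ-injective (ℕ.+-cancelʳ-≡ k _ _ (trans (sym p) q))
    cases (inj₁ p) (inj₂ q) = contradiction (Fin.toℕ<n i) (ℕ.≤⇒≯ (subst (k ≤_) (trans (sym q) p) (ℕ.m≤n+m k (toℕ l))))
    cases (inj₂ p) (inj₁ q) = contradiction (Fin.toℕ<n l) (ℕ.≤⇒≯ (subst (k ≤_) (trans (sym p) q) (ℕ.m≤n+m k (toℕ i))))

  module _ (r : ℕ) (2s≤k : 2 * suc r ≤ k) where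

    s : ℕ
    s = suc r

    s≤k : s ≤ k
    s≤k = ℕ.≤-trans (ℕ.m≤m+n s (s + 0)) 2s≤k

    Fin-s≤k : ∀ (a : Fin s) → toℕ a ≤ k
    Fin-s≤k a = ℕ.≤-trans (ℕ.<⇒≤ (Fin.toℕ<n a)) s≤k

    -- Slot `a` of part `i` is put into window `i − a` modulo `k`, so window `w` meets the parts
    -- `w`, ..., `w + r`, and its determined slot is in part `w`.
    slot : Fin k → Fin s → Fin k ⊎ Fin (k * r)
    slot i zero    = inj₁ i
    slot i (suc a) = inj₂ (combine i a)

    freeWindow : Fin k × Fin r → Fin k
    freeWindow (i , a) = proj₁ (back i (toℕ (suc a)) (Fin-s≤k (suc a)))

    window : Fin (k * r) → Fin k
    window u = freeWindow (remQuot r u)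

    windowOf : Fin k ⊎ Fin (k * r) → Fin k
    windowOf = [ id , window ]′

    windowOf-slot : ∀ i a → toℕ (windowOf (slot i a)) + toℕ a ≡ toℕ i ⊎ toℕ (windowOf (slot i a)) + toℕ a ≡ toℕ i + k
    windowOf-slot i zero    = inj₁ (ℕ.+-identityʳ _)
    windowOf-slot i (suc a) =
      subst (λ ia → toℕ (freeWindow ia) + suc (toℕ a) ≡ toℕ i ⊎ toℕ (freeWindow ia) + suc (toℕ a) ≡ toℕ i + k)
            (sym (Fin.remQuot-combine i a)) (proj₂ (back i (suc (toℕ a)) (Fin-s≤k (suc a))))

    +k-absurd : ∀ {w a i b} → w + a ≡ i → w + b ≡ i + k → ¬ b < k
    +k-absurd {w} {a} {i} {b} e e' b<k = ℕ.<⇒≱ b<k (ℕ.+-cancelˡ-≤ w k b (begin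
      w + k       ≤⟨ ℕ.+-monoˡ-≤ k (ℕ.m≤m+n w a) ⟩
      w + a + k   ≡⟨ cong (_+ k) e ⟩
      i + k       ≡⟨ e' ⟨
      w + b       ∎))
      where open ℕ.≤-Reasoning

    window-injective : ∀ i a b → windowOf (slot i a) ≡ windowOf (slot i b) → a ≡ b
    window-injective i a b e with windowOf-slot i a | windowOf-slot i b
    ... | inj₁ p | inj₁ q rewrite e = toℕ-injective (ℕ.+-cancelˡ-≡ _ _ _ (trans p (sym q)))
    ... | inj₂ p | inj₂ q rewrite e = toℕ-injective (ℕ.+-cancelˡ-≡ _ _ _ (trans p (sym q)))
    ... | inj₁ p | inj₂ q rewrite e = contradiction (ℕ.<-≤-trans (Fin.toℕ<n b) s≤k) (+k-absurd p q)
    ... | inj₂ p | inj₁ q rewrite e = contradiction (ℕ.<-≤-trans (Fin.toℕ<n a) s≤k) (+k-absurd q p)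

    slot-surjective : ∀ σ → ∃₂ λ i a → slot i a ≡ σ
    slot-surjective (inj₁ i) = i , zero , refl
    slot-surjective (inj₂ u) = let i , a = remQuot {k} r u in i , suc a , cong inj₂ (Fin.combine-remQuot {k} r u)

    -- Parts sharing window `w` are `w + a` and `w + b` modulo `k` with `a` and `b` below `s`; the
    -- excluded inequalities put them at least `s` apart in both directions round the cycle.
    far : ∀ {i l} → (∃₂ λ a b → windowOf (slot i a) ≡ windowOf (slot l b)) →
          ¬ (toℕ i + s ≤ toℕ l × toℕ l + s ≤ toℕ i + k)
    far {i} {l} (a , b , e) (i+s≤l , l+s≤i+k) with windowOf-slot i a | windowOf-slot l b
    ... | p | q rewrite e = bad p q
      where
      w = toℕ (windowOf (slot l b))
      a+s≰b : ¬ w + toℕ a + s ≤ w + toℕ b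
      a+s≰b h = ℕ.<⇒≱ (Fin.toℕ<n b) (ℕ.≤-trans (ℕ.m≤n+m s (toℕ a))
        (ℕ.+-cancelˡ-≤ w _ _ (subst (_≤ w + toℕ b) (ℕ.+-assoc w (toℕ a) s) h)))
      b+s≰a : ¬ w + toℕ b + s ≤ w + toℕ a
      b+s≰a h = ℕ.<⇒≱ (Fin.toℕ<n a) (ℕ.≤-trans (ℕ.m≤n+m s (toℕ b))
        (ℕ.+-cancelˡ-≤ w _ _ (subst (_≤ w + toℕ a) (ℕ.+-assoc w (toℕ b) s) h)))
      bad : w + toℕ a ≡ toℕ i ⊎ w + toℕ a ≡ toℕ i + k → ¬ (w + toℕ b ≡ toℕ l ⊎ w + toℕ b ≡ toℕ l + k)
      bad (inj₁ p) (inj₁ q) = a+s≰b (subst₂ (λ x y → x + s ≤ y) (sym p) (sym q) i+s≤l)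
      bad (inj₂ p) (inj₂ q) = a+s≰b (subst₂ (λ x y → x + s ≤ y) (sym p) (sym q)
        (subst (_≤ toℕ l + k) (shuffle (toℕ i) s k) (ℕ.+-monoˡ-≤ k i+s≤l)))
        where
        shuffle : ∀ x y z → x + y + z ≡ x + z + y
        shuffle = solve-∀
      bad (inj₁ p) (inj₂ q) = a+s≰b (subst₂ (λ x y → x + s ≤ y) (sym p) (sym q) (ℕ.≤-trans i+s≤l (ℕ.m≤m+n _ k)))
      bad (inj₂ p) (inj₁ q) = b+s≰a (subst₂ (λ x y → x + s ≤ y) (sym q) (sym p) l+s≤i+k)

    -- Relative to the least part x of a clique, the offset of another part lies in [1, r] or in [k − r, k − 1].
    -- Offsets c and k − s + c do not occur together, which leaves at most r further parts.
    free : (g : Fin (suc s) → Fin k) →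
           ¬ (∀ a b → a ≢ b → g a ≢ g b × ∃₂ λ c d → windowOf (slot (g a) c) ≡ windowOf (slot (g b) d))
    free g clique = let a , b , a<b , e = Fin.pigeonhole (ℕ.n<1+n r) (proj₁ ∘ offset) in
                    clash a b (Fin.<⇒≢ a<b) e (proj₂ (offset a)) (proj₂ (offset b))
      where
      o = proj₁ (minimum (toℕ ∘ g))
      x = toℕ (g o)
      y : Fin s → ℕ
      y a = toℕ (g (punchIn o a))
      -- With `c` counted from zero, the offsets are `c + 1` and `k − s + c + 1`.
      Offset : Fin s → Fin r → Set
      Offset a c = suc x + toℕ c ≡ y a ⊎ suc (x + k) + toℕ c ≡ y a + s
      Shared : Fin k → Fin k → Set
      Shared i l = i ≢ l × ∃₂ λ c d → windowOf (slot i c) ≡ windowOf (slot l d)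
      o-clique : ∀ a → Shared (g o) (g (punchIn o a))
      o-clique a = clique o (punchIn o a) (Fin.punchInᵢ≢i o a ∘ sym)
      offset : ∀ a → ∃ λ c → Offset a c
      offset a with ℕ.m≤n⇒∃[o]m+o≡n (ℕ.≤∧≢⇒< (proj₂ (minimum (toℕ ∘ g)) (punchIn o a)) (proj₁ (o-clique a) ∘ toℕ-injective))
      ... | δ , eq with δ ℕ.<? r
      ...   | yes δ<r = fromℕ< δ<r , inj₁ (trans (cong (suc x +_) (Fin.toℕ-fromℕ< δ<r)) eq)
      -- Here `x + s ≤ y a`, so `far` forces `y a + s` beyond `x + k`; the excess gives `c`, and
      -- `y a < k` bounds it.
      ...   | no δ≮r with ℕ.m≤n⇒∃[o]m+o≡n (ℕ.≰⇒> (λ y+s≤x+k → far (proj₂ (o-clique a)) (x+s≤y , y+s≤x+k)))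
        where
        x+s≤y : x + s ≤ y a
        x+s≤y = subst₂ _≤_ (sym (ℕ.+-suc x r)) eq (ℕ.+-monoʳ-≤ (suc x) (ℕ.≮⇒≥ δ≮r))
      ...     | c , eq' = fromℕ< c<r , inj₂ (trans (cong (suc (x + k) +_) (Fin.toℕ-fromℕ< c<r)) eq')
        where
        c<r : c < r
        c<r = ℕ.+-cancelˡ-< (suc (x + k)) c r (begin-strict
          suc (x + k) + c ≡⟨ eq' ⟩
          y a + s         <⟨ ℕ.+-monoˡ-< s (Fin.toℕ<n (g (punchIn o a))) ⟩
          k + s           ≤⟨ ℕ.m≤n+m (k + s) x ⟩
          x + (k + s)     ≡⟨ shuffle x k r ⟩
          suc (x + k) + r ∎)
          where
          open ℕ.≤-Reasoning
          shuffle : ∀ x k r → x + (k + suc r) ≡ suc (x + k) + r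
          shuffle = solve-∀
      -- The two parts differ by exactly `k − s`, which is at least `s` because `2 * s ≤ k`; `far`
      -- applies.
      mixed : ∀ a b c → Shared (g (punchIn o a)) (g (punchIn o b)) →
              suc x + c ≡ y a → ¬ suc (x + k) + c ≡ y b + s
      mixed a b c (_ , shared) p q = far shared (ya+s≤yb , ℕ.≤-reflexive yb+s≡ya+k)
        where
        shuffle : ∀ x k c → suc (x + k) + c ≡ suc x + c + k
        shuffle = solve-∀
        yb+s≡ya+k : y b + s ≡ y a + k
        yb+s≡ya+k = trans (sym q) (trans (shuffle x k c) (cong (_+ k) p))
        ya+s≤yb : y a + s ≤ y b
        ya+s≤yb = ℕ.+-cancelʳ-≤ s _ _ (begin
          y a + s + s   ≡⟨ double (y a) s ⟩
          y a + 2 * s   ≤⟨ ℕ.+-monoʳ-≤ (y a) 2s≤k ⟩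
          y a + k       ≡⟨ yb+s≡ya+k ⟨
          y b + s       ∎)
          where
          open ℕ.≤-Reasoning
          double : ∀ a s → a + s + s ≡ a + 2 * s
          double = solve-∀
      clash : ∀ a b → a ≢ b → proj₁ (offset a) ≡ proj₁ (offset b) → Offset a (proj₁ (offset a)) → ¬ Offset b (proj₁ (offset b))
      clash a b a≢b e p q = cases (subst (Offset a) e p) q
        where
        ab = clique (punchIn o a) (punchIn o b) (a≢b ∘ Fin.punchIn-injective o a b)
        ba = clique (punchIn o b) (punchIn o a) (a≢b ∘ sym ∘ Fin.punchIn-injective o b a)
        cases : ∀ {c} → Offset a c → ¬ Offset b c
        cases (inj₁ p) (inj₁ q) = proj₁ ab (toℕ-injective (trans (sym p) q))
        cases (inj₂ p) (inj₂ q) = proj₁ ab (toℕ-injective (ℕ.+-cancelʳ-≡ s _ _ (trans (sym p) q)))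
        cases (inj₁ p) (inj₂ q) = mixed a b _ ab p q
        cases (inj₂ p) (inj₁ q) = mixed b a _ ba q p

    layout : Layout k (suc s) s k (k * r)
    layout = record
      { slot = slot ; window = window ; slot-surjective = slot-surjective
      ; window-injective = window-injective ; ~-free = free }

  -- For `r = 1` the one free slot of part `i` lies in window `i − 1`, and rotation is injective.
  window₁-injective : ∀ (4≤k : 2 * 2 ≤ k) {u u'} → window 1 4≤k u ≡ window 1 4≤k u' → u ≡ u'
  window₁-injective 4≤k {u} {u'} e = begin
    u                                ≡⟨ Fin.combine-remQuot {k} 1 u ⟨
    uncurry combine (remQuot {k} 1 u)    ≡⟨ cong (uncurry combine) (freeWindow-injective (remQuot 1 u) (remQuot 1 u') e) ⟩
    uncurry combine (remQuot {k} 1 u')   ≡⟨ Fin.combine-remQuot {k} 1 u' ⟩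
    u'                               ∎
    where
    open ≡-Reasoning
    freeWindow-injective : ∀ ia lb → freeWindow 1 4≤k ia ≡ freeWindow 1 4≤k lb → ia ≡ lb
    freeWindow-injective (i , zero) (l , zero) e = cong (_, zero) (back-injective {i} {l} (Fin-s≤k 1 4≤k (suc zero)) e)

-- Asymptotics

-- An upward search from `L`, with `d` bounding the number of steps.
crossing : ∀ (g : ℕ → ℕ) {n} L d → g L ≤ n → n < g (d + L) → ∃ λ b → L ≤ b × g b ≤ n × n < g (suc b)
crossing g L zero    lo hi = contradiction hi (ℕ.≤⇒≯ lo)
crossing g {n} L (suc d) lo hi with g (suc L) ℕ.≤? n
... | no  gap = L , ℕ.≤-refl , lo , ℕ.≰⇒> gap
... | yes up with crossing g (suc L) d up (subst (λ i → n < g i) (sym (ℕ.+-suc d L)) hi)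
...   | b , L<b , r = b , ℕ.<⇒≤ L<b , r

^-distribʳ-* : ∀ q a b → (a * b) ^ q ≡ a ^ q * b ^ q
^-distribʳ-* zero    a b = refl
^-distribʳ-* (suc q) a b = trans (cong (a * b *_) (^-distribʳ-* q a b)) (interchange a b (a ^ q) (b ^ q))
  where
  interchange : ∀ x y z w → (x * y) * (z * w) ≡ (x * z) * (y * w)
  interchange = solve-∀

m≤m^1+n : ∀ m n → m ≤ m ^ suc n
m≤m^1+n zero    n = z≤n
m≤m^1+n (suc m) n = subst (_≤ suc m ^ suc n) (ℕ.*-identityʳ (suc m)) (ℕ.^-monoʳ-≤ (suc m) {1} {suc n} (s≤s z≤n))

-- Take `b` where `k * (c * b) ^ q` crosses `n`; since `suc b ≤ 2 * b`, overshooting by one step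
-- costs only a constant factor.
scale : ∀ k' c' q' L' {n} (let k = suc k') (let c = suc c') (let q = suc q') →
        k * (c * suc L') ^ q ≤ n →
        ∃ λ b' → L' ≤ b' × k * (c * suc b') ^ q ≤ n × n ≤ (k * (c * 2) ^ q) * suc b' ^ q
scale k' c' q' L' {n} lo with crossing (λ b → k * (c * b) ^ q) (suc L') n lo large
  where
  k = suc k'
  c = suc c'
  q = suc q'
  large : n < k * (c * (n + suc L')) ^ q
  large = begin-strict
    n                            <⟨ ℕ.m<m+n n (s≤s z≤n) ⟩
    n + suc L'                   ≤⟨ ℕ.m≤n*m (n + suc L') c ⟩
    c * (n + suc L')             ≤⟨ m≤m^1+n (c * (n + suc L')) q' ⟩
    (c * (n + suc L')) ^ q       ≤⟨ ℕ.m≤n*m ((c * (n + suc L')) ^ q) k ⟩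
    k * (c * (n + suc L')) ^ q   ∎
    where open ℕ.≤-Reasoning
... | suc b' , s≤s L'≤b' , lo' , hi = b' , L'≤b' , lo' , (begin
    n                               ≤⟨ ℕ.<⇒≤ hi ⟩
    k * (c * suc b) ^ q             ≤⟨ ℕ.*-monoʳ-≤ k (ℕ.^-monoˡ-≤ q (ℕ.*-monoʳ-≤ c 1+b≤2b)) ⟩
    k * (c * (2 * b)) ^ q           ≡⟨ cong (λ a → k * a ^ q) (ℕ.*-assoc c 2 b) ⟨
    k * (c * 2 * b) ^ q             ≡⟨ cong (k *_) (^-distribʳ-* q (c * 2) b) ⟩
    k * ((c * 2) ^ q * b ^ q)       ≡⟨ ℕ.*-assoc k ((c * 2) ^ q) (b ^ q) ⟨
    (k * (c * 2) ^ q) * b ^ q       ∎)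
  where
  open ℕ.≤-Reasoning
  k = suc k'
  c = suc c'
  q = suc q'
  b = suc b'
  1+b≤2b : suc b ≤ 2 * b
  1+b≤2b = ℕ.+-mono-≤ {1} {b} (s≤s z≤n) (ℕ.m≤m+n b 0)

-- An alphabet of size `b` needs about `b ^ p` vertices and gives `b ^ f` configurations up to a
-- constant; taking `p`-th powers avoids the fractional exponent `f / p`.
equality-bound : ∀ {k' p' J f} (let k = suc k') (let p = suc p') (L : Layout k 3 p J f) →
                 (∀ {u u'} → Layout.window L u ≡ Layout.window L u' → u ≡ u') →
                 ∃[ C ] ∃[ N₀ ] (1 ≤ C × (∀ n → N₀ ≤ n → n ^ f ≤ (C * m 3 n k) ^ p))
equality-bound {k'} {p'} {J} {f} L window-inj =
  C , k * (1 * 1) ^ p , ℕ.*-mono-≤ 1≤D^f (ℕ.m^n>0 3 E) , bound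
  where
  k = suc k'
  p = suc p'
  E = p * p * k * k
  D = k * 2 ^ p
  C = D ^ f * 3 ^ E
  1≤D : 1 ≤ D
  1≤D = ℕ.*-mono-≤ {1} {k} (s≤s z≤n) (ℕ.m^n>0 2 p)
  1≤D^f : 1 ≤ D ^ f
  1≤D^f = ℕ.m^n>0 D {{>-nonZero 1≤D}} f
  bound : ∀ n → k * (1 * 1) ^ p ≤ n → n ^ f ≤ (C * m 3 n k) ^ p
  bound n lo with scale k' 0 p' 0 lo
  ... | q , _ , fits , n≤ = begin
    n ^ f                               ≤⟨ ℕ.^-monoˡ-≤ f n≤ ⟩
    (D * b ^ p) ^ f                     ≡⟨ ^-distribʳ-* f D (b ^ p) ⟩
    D ^ f * (b ^ p) ^ f                 ≡⟨ cong (D ^ f *_) swap ⟩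
    D ^ f * (b ^ f) ^ p                 ≤⟨ ℕ.*-mono-≤ (m≤m^1+n (D ^ f) p') (ℕ.^-monoˡ-≤ p count) ⟩
    (D ^ f) ^ p * (3 ^ E * m 3 n k) ^ p ≡⟨ ^-distribʳ-* p (D ^ f) _ ⟨
    (D ^ f * (3 ^ E * m 3 n k)) ^ p     ≡⟨ cong (_^ p) (ℕ.*-assoc (D ^ f) (3 ^ E) (m 3 n k)) ⟨
    (C * m 3 n k) ^ p                   ∎
    where
    open ℕ.≤-Reasoning
    b = suc q
    swap : (b ^ p) ^ f ≡ (b ^ f) ^ p
    swap = trans (ℕ.^-*-assoc b p f) (trans (cong (b ^_) (ℕ.*-comm p f)) (sym (ℕ.^-*-assoc b f p)))
    count : b ^ f ≤ 3 ^ E * m 3 n k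
    count = coding⇒≤m (equalityCoding {L = L} q window-inj)
      (subst (λ a → k * a ^ p ≤ n) (ℕ.*-identityˡ b) fits)

-- With d coordinates the pigeonhole principle costs a factor (A b²)^E, that is n^O(E/d); hence the choice of d.
gram-bound : ∀ {k' t' p' J f} (let k = suc k') (let t = suc (suc (suc t'))) (let p = suc p') (L : Layout k t p J f) →
             ∀ e → ∃[ N₀ ] (∀ n → N₀ ≤ n → n ^ (f * suc e ∸ p) ≤ m t n k ^ (p * suc e))
gram-bound {k'} {t'} {p'} {J} {f} L e = k * (K * suc Λ) ^ (d * p) , bound
  where
  k = suc k'
  t = suc (suc (suc t'))
  p = suc p'
  h = suc e
  K = suc f
  E = p * p * k * k
  -- Then `b ^ (d * p)` covers the pigeonhole loss `b ^ (2 * E * h * p)` with at least one factor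
  -- `b` to spare.
  d = suc (2 * E * h)
  g = f * h ∸ p
  D = k * (K * 2) ^ (d * p)
  A = suc (d * (K * K))
  -- All constant factors together; the threshold on `n` makes `b` exceed `Λ`, so the spare factor
  -- absorbs them.
  Λ = D ^ g * A ^ (E * (p * h))
  bound : ∀ n → k * (K * suc Λ) ^ (d * p) ≤ n → n ^ g ≤ m t n k ^ (p * h)
  bound n lo with scale k' f (p' + 2 * E * h * p) Λ lo
  ... | b' , Λ≤b' , fits , n≤ = byCases (p ℕ.≤? f * h)
    where
    open ℕ.≤-Reasoning
    b = suc b'
    P = suc (d * ((K * b) * (K * b)))
    X = (P ^ E) ^ (p * h)
    M = m t n k
    count : (b ^ d) ^ f ≤ P ^ E * M
    count = coding⇒≤m (gramCoding {L = L} b' d)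
      (subst (λ a → k * a ≤ n) (sym (ℕ.^-*-assoc (K * b) d p)) fits)
    P≤ : P ≤ A * b ^ 2
    P≤ = begin
      1 + d * ((K * b) * (K * b))     ≡⟨ cong (1 +_) (regroup d K b) ⟩
      1 + d * (K * K) * b ^ 2         ≤⟨ ℕ.+-monoˡ-≤ _ (ℕ.m^n>0 b 2) ⟩
      A * b ^ 2                       ∎
      where
      regroup : ∀ d K b → d * ((K * b) * (K * b)) ≡ d * (K * K) * (b * (b * 1))
      regroup = solve-∀
    X≤ : X ≤ A ^ (E * (p * h)) * b ^ (2 * (E * (p * h)))
    X≤ = begin
      (P ^ E) ^ (p * h)                                ≡⟨ ℕ.^-*-assoc P E (p * h) ⟩
      P ^ (E * (p * h))                                ≤⟨ ℕ.^-monoˡ-≤ (E * (p * h)) P≤ ⟩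
      (A * b ^ 2) ^ (E * (p * h))                      ≡⟨ ^-distribʳ-* (E * (p * h)) A (b ^ 2) ⟩
      A ^ (E * (p * h)) * (b ^ 2) ^ (E * (p * h))      ≡⟨ cong (A ^ (E * (p * h)) *_) (ℕ.^-*-assoc b 2 (E * (p * h))) ⟩
      A ^ (E * (p * h)) * b ^ (2 * (E * (p * h)))      ∎
    n^g≤ : n ^ g ≤ D ^ g * b ^ (d * p * g)
    n^g≤ = begin
      n ^ g                       ≤⟨ ℕ.^-monoˡ-≤ g n≤ ⟩
      (D * b ^ (d * p)) ^ g       ≡⟨ ^-distribʳ-* g D _ ⟩
      D ^ g * (b ^ (d * p)) ^ g   ≡⟨ cong (D ^ g *_) (ℕ.^-*-assoc b (d * p) g) ⟩
      D ^ g * b ^ (d * p * g)     ∎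
    exponent : p ≤ f * h → 1 + (d * p * g + 2 * (E * (p * h))) ≤ d * f * (p * h)
    exponent p≤fh = begin
      1 + (d * p * g + 2 * (E * (p * h)))     ≡⟨ regroup₁ (d * p * g) E p' h ⟩
      d * p * g + (1 + 2 * E * h * p)         ≤⟨ ℕ.+-monoʳ-≤ (d * p * g) (ℕ.+-monoˡ-≤ (2 * E * h * p) (s≤s (z≤n {p'}))) ⟩
      d * p * g + d * p                       ≤⟨ ℕ.+-monoʳ-≤ (d * p * g) (ℕ.m≤m*n (d * p) p) ⟩
      d * p * g + d * p * p                   ≡⟨ ℕ.*-distribˡ-+ (d * p) g p ⟨
      d * p * (g + p)                         ≡⟨ cong (d * p *_) (ℕ.m∸n+n≡m p≤fh) ⟩
      d * p * (f * h)                         ≡⟨ regroup₂ d p f h ⟩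
      d * f * (p * h)                         ∎
      where
      regroup₁ : ∀ x E p' h → 1 + (x + 2 * (E * (suc p' * h))) ≡ x + (1 + 2 * E * h * suc p')
      regroup₁ = solve-∀
      regroup₂ : ∀ d p f h → d * p * (f * h) ≡ d * f * (p * h)
      regroup₂ = solve-∀
    byCases : Dec (p ≤ f * h) → n ^ g ≤ M ^ (p * h)
    -- The truncated exponent is zero, and what remains is that some `k`-MIS exists, which `count`
    -- supplies.
    byCases (no p≰fh) = subst (λ g → n ^ g ≤ M ^ (p * h)) (sym (ℕ.m≤n⇒m∸n≡0 (ℕ.<⇒≤ (ℕ.≰⇒> p≰fh)))) (ℕ.m^n>0 M {{M≢0}} (p * h))
      where
      M≢0 : NonZero M
      M≢0 = ≢-nonZero λ M≡0 → ℕ.<⇒≱ (ℕ.m^n>0 (b ^ d) {{ℕ.m^n≢0 b d}} f)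
        (subst ((b ^ d) ^ f ≤_) (trans (cong (P ^ E *_) M≡0) (ℕ.*-zeroʳ (P ^ E))) count)
    -- Both sides are multiplied by the pigeonhole loss `X`, which is cancelled at the end.
    byCases (yes p≤fh) = ℕ.*-cancelʳ-≤ (n ^ g) (M ^ (p * h)) X {{ℕ.m^n≢0 (P ^ E) (p * h) {{ℕ.m^n≢0 P E}}}} (begin
      n ^ g * X
        ≤⟨ ℕ.*-mono-≤ n^g≤ X≤ ⟩
      (D ^ g * b ^ (d * p * g)) * (A ^ (E * (p * h)) * b ^ (2 * (E * (p * h))))
        ≡⟨ regroup (D ^ g) (b ^ (d * p * g)) (A ^ (E * (p * h))) _ ⟩
      Λ * (b ^ (d * p * g) * b ^ (2 * (E * (p * h))))
        ≡⟨ cong (Λ *_) (ℕ.^-distribˡ-+-* b (d * p * g) (2 * (E * (p * h)))) ⟨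
      Λ * b ^ (d * p * g + 2 * (E * (p * h)))
        ≤⟨ ℕ.*-monoˡ-≤ _ (ℕ.≤-trans Λ≤b' (ℕ.n≤1+n b')) ⟩
      b ^ (1 + (d * p * g + 2 * (E * (p * h))))
        ≤⟨ ℕ.^-monoʳ-≤ b (exponent p≤fh) ⟩
      b ^ (d * f * (p * h))
        ≡⟨ trans (cong (_^ (p * h)) (ℕ.^-*-assoc b d f)) (ℕ.^-*-assoc b (d * f) (p * h)) ⟨
      ((b ^ d) ^ f) ^ (p * h)
        ≤⟨ ℕ.^-monoˡ-≤ (p * h) count ⟩
      (P ^ E * M) ^ (p * h)
        ≡⟨ ^-distribʳ-* (p * h) (P ^ E) M ⟩
      X * M ^ (p * h)
        ≡⟨ ℕ.*-comm X _ ⟩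
      M ^ (p * h) * X ∎)
      where
      regroup : ∀ x y z w → (x * y) * (z * w) ≡ (x * z) * (y * w)
      regroup = solve-∀

-- The slack `x = r * J − f` satisfies `r * (J + f) = x + f * suc r`, and `small` says `x < suc r`.
floor-free : ∀ r J f → J + f ≤ suc r * J → r * J < suc r + f → r * (J + f) / suc r ≡ f
floor-free r J f bound small with ℕ.m≤n⇒∃[o]m+o≡n (ℕ.+-cancelˡ-≤ J f (r * J) bound)
... | x , f+x≡rJ = begin
  r * (J + f) / suc r              ≡⟨ cong (_/ suc r) split ⟩
  (x + f * suc r) / suc r          ≡⟨ ℕ.+-distrib-/-∣ʳ x (n∣m*n f) ⟩
  x / suc r + f * suc r / suc r    ≡⟨ cong₂ _+_ (ℕ.m<n⇒m/n≡0 x<s) (ℕ.m*n/n≡m f (suc r)) ⟩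
  f                                ∎
  where
  open ≡-Reasoning
  x<s : x < suc r
  x<s = ℕ.+-cancelˡ-< f x (suc r) (subst₂ _<_ (sym f+x≡rJ) (ℕ.+-comm (suc r) f) small)
  regroup : ∀ f x r → f + x + r * f ≡ x + f * suc r
  regroup = solve-∀
  split : r * (J + f) ≡ x + f * suc r
  split = trans (ℕ.*-distribˡ-+ r J f) (trans (cong (_+ r * f) (sym f+x≡rJ)) (regroup f x r))

-- With `h = suc e`, the o(1) bounds say that `m t n k` is eventually at least n to the stated
-- exponent minus `1 / h`, for every `h`; powers clear the denominators, as they do for `k / 2`.
theorem1p4 : (k t : ℕ) → 1 ≤ k → 3 ≤ t →
    ((t ≡ 3 → k < 4 →
    ∃[ C ] ∃[ N₀ ] (1 ≤ C × (∀ n → N₀ ≤ n → k ≤ n →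
    n ^ (k / 2) ≤ C * m 3 n k)))
    × (4 ≤ t → k < 2 * (t ∸ 1) →
    ∀ e → ∃[ N₀ ] (∀ n → N₀ ≤ n → k ≤ n →
    n ^ (((t ∸ 2) * k / suc (t ∸ 2)) * suc e ∸ 1) ≤ m t n k ^ suc e)))
    ×
    ((t ≡ 3 → 4 ≤ k →
    ∃[ C ] ∃[ N₀ ] (1 ≤ C × (∀ n → N₀ ≤ n → k ≤ n →
    n ^ k ≤ (C * m 3 n k) ^ 2)))
    × (4 ≤ t → 2 * (t ∸ 1) ≤ k →
    ∀ e → ∃[ N₀ ] (∀ n → N₀ ≤ n → k ≤ n →
    n ^ ((t ∸ 2) * k * suc e ∸ (t ∸ 1)) ≤ m t n k ^ ((t ∸ 1) * suc e))))
theorem1p4 (suc k') (suc (suc (suc t'))) _ (s≤s (s≤s (s≤s _))) =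
  ((λ { refl k<4 → a₃ k' k<4 }) , λ _ k<2s → aₜ k' k<2s) ,
  ((λ { refl 4≤k → b₃ 4≤k }) , λ _ 2s≤k → bₜ 2s≤k)
  where
  k = suc k'
  t = suc (suc (suc t'))
  s = suc (suc t')
  r = suc t'

  residue₃ : ∀ J' f (let J = suc J') → J + f ≤ 2 * J →
             ∃[ C ] ∃[ N₀ ] (1 ≤ C × (∀ n → N₀ ≤ n → J + f ≤ n → n ^ f ≤ C * m 3 n (J + f)))
  residue₃ J' f bound =
    let C , N₀ , 1≤C , h = equality-bound (residueLayout 2 J' f bound) (residueLayout-window-injective J' f bound)
    in C , N₀ , 1≤C , λ n n≥ _ → subst (n ^ f ≤_) (ℕ.*-identityʳ _) (h n n≥)

  a₃ : ∀ k' → suc k' < 4 → ∃[ C ] ∃[ N₀ ] (1 ≤ C × (∀ n → N₀ ≤ n → suc k' ≤ n → n ^ (suc k' / 2) ≤ C * m 3 n (suc k')))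
  -- The pairs `(J , f)` are (1, 0), (1, 1) and (2, 1), where `f` is the floor of half of `J + f`.
  a₃ 0 _ = residue₃ 0 0 (ℕ.m≤m+n 1 1)
  a₃ 1 _ = residue₃ 0 1 (ℕ.m≤m+n 2 0)
  a₃ 2 _ = residue₃ 1 1 (ℕ.m≤m+n 3 1)
  a₃ (suc (suc (suc _))) (s≤s (s≤s (s≤s (s≤s ()))))

  residueₜ : ∀ J' f (let J = suc J') → J + f ≤ s * J → r * J < s + f → ∀ e →
             ∃[ N₀ ] (∀ n → N₀ ≤ n → J + f ≤ n → n ^ ((r * (J + f) / s) * suc e ∸ 1) ≤ m t n (J + f) ^ suc e)
  residueₜ J' f bound small e =
    let N₀ , h = gram-bound {t' = t'} (residueLayout s J' f bound) e
    in N₀ , λ n n≥ _ → subst₂ (λ x y → n ^ (x * suc e ∸ 1) ≤ m t n (suc J' + f) ^ y)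
         (sym (floor-free r (suc J') f bound small)) (ℕ.*-identityˡ (suc e)) (h n n≥)

  aₜ : ∀ k' → suc k' < 2 * s → ∀ e →
       ∃[ N₀ ] (∀ n → N₀ ≤ n → suc k' ≤ n → n ^ ((r * suc k' / s) * suc e ∸ 1) ≤ m t n (suc k') ^ suc e)
  -- One window holds all parts when `k ≤ s`, two are used otherwise; the floor is then `k − 1` or
  -- `k − 2`, the number of free slots.
  aₜ k' k<2s e with suc k' ℕ.≤? s
  ... | yes k≤s = residueₜ 0 k' (subst (suc k' ≤_) (sym (ℕ.*-identityʳ s)) k≤s)
                    (subst (_< s + k') (sym (ℕ.*-identityʳ r)) (ℕ.m≤m+n s k')) e
  aₜ zero    _    _ | no k≰s = contradiction (s≤s z≤n) k≰s
  aₜ (suc f) k<2s e | no k≰s = residueₜ 1 f (ℕ.≤-trans (ℕ.<⇒≤ k<2s) (ℕ.≤-reflexive (ℕ.*-comm 2 s)))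
                    (s≤s (subst (_≤ r + f) (double r) (ℕ.+-monoʳ-≤ r (ℕ.≤-pred (ℕ.≤-pred (ℕ.≰⇒> k≰s)))))) e
    where
    double : ∀ r → r + r ≡ r * 2
    double = solve-∀

  b₃ : 4 ≤ k → ∃[ C ] ∃[ N₀ ] (1 ≤ C × (∀ n → N₀ ≤ n → k ≤ n → n ^ k ≤ (C * m 3 n k) ^ 2))
  b₃ 4≤k =
    let C , N₀ , 1≤C , h = equality-bound (Cyclic.layout k 1 4≤k) (λ {u} {u'} → Cyclic.window₁-injective k 4≤k {u} {u'})
    in C , N₀ , 1≤C , λ n n≥ _ → subst (λ x → n ^ x ≤ (C * m 3 n k) ^ 2) (ℕ.*-identityʳ k) (h n n≥)

  bₜ : 2 * s ≤ k → ∀ e → ∃[ N₀ ] (∀ n → N₀ ≤ n → k ≤ n → n ^ (r * k * suc e ∸ s) ≤ m t n k ^ (s * suc e))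
  -- The cyclic layout has `p = s` and `f = k * r`, hence the exponent `r k / s`.
  bₜ 2s≤k e =
    let N₀ , h = gram-bound {t' = t'} (Cyclic.layout k r 2s≤k) e
    in N₀ , λ n n≥ _ → subst (λ x → n ^ (x * suc e ∸ s) ≤ m t n k ^ (s * suc e)) (ℕ.*-comm k r) (h n n≥)
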